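{- Let $n>3$ be odd, let $Q$ be a nondegenerate quadratic form on $\mathbb{F}_5^n$ with associated bilinear form $B$, and let $\varepsilon=\mu\bigl((-1)^{\frac{n-1}{2}}\det Q\bigr)$. Let $S^+=\{\{\mathbf v,-\mathbf v\} : \mathbf v\in\mathbb{F}_5^n,\ Q(\mathbf v)=1\}$, and let $A_0,A_1,A_2$ be the adjacency matrices of the relations on $S^+$ $$\mathcal R_0=\{(\mathbf v,\mathbf u): B(\mathbf v,\mathbf u)=0\},\quad \mathcal R_1=\{(\mathbf v,\mathbf u): \mathbf v\neq\mathbf u,\ B(\mathbf v,\mathbf u)=\pm1\},\quad \mathcal R_2=\{(\mathbf v,\mathbf u): B(\mathbf v,\mathbf u)=\pm2\}.$$ Then $A_2$ is the adjacency matrix of an edge-regular Deza graph with parameters $$ \left( \frac{5^{n-1} + \varepsilon 5^{\frac{n-1}{2}}}{2},\; 5^{n-2} - \varepsilon 5^{\frac{n-3}{2}},\; 2(5^{n-3} - \varepsilon 5^{\frac{n-3}{2}}),\; 2\cdot5^{n-3} - \varepsilon 5^{\frac{n-3}{2}} \right). $$ Moreover, $A_0$ and $A_1+A_2$ are adjacency matrices of complementary strongly regular graphs, the graphs with adjacency matrices $A_0$ and $A_1+A_2$ are the children of the Deza graph with adjacency matrix $A_2$, and $A_0$ is the adjacency matrix of a strongly regular graph with parameters $$ \left( \frac{5^{n-1} + \varepsilon 5^{\frac{n-1}{2}}}{2},\; \frac{5^{n-2} - \varepsilon 5^{\frac{n-3}{2}}}{2},\; \frac{5^{n-3} + \varepsilon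 5^{\frac{n-3}{2}}}{2},\; \frac{5^{n-3} - \varepsilon 5^{\frac{n-3}{2}}}{2} \right). $$
   Context: $B(\mathbf x,\mathbf y)=\frac12(Q(\mathbf x+\mathbf y)-Q(\mathbf x)-Q(\mathbf y))$, so $B(\mathbf x,\mathbf x)=Q(\mathbf x)$. Every nondegenerate quadratic form over a finite field of odd characteristic is equivalent to some $x_1^2+\dots+x_{n-1}^2+d x_n^2$ with $d\neq0$; one sets $\det Q=d$ (well defined up to nonzero squares). $\mu$ is the quadratic character of $\mathbb{F}_5$ ($\mu(0)=0$). An element $\{\mathbf v,-\mathbf v\}$ of $S^+$ is identified with either representative $\mathbf v$ (so $\mathbf v\ne\mathbf u$ in $S^+$ means $\mathbf v\neq\pm\mathbf u$ as vectors); $B$ is then defined up to sign. Graphs are finite, simple and undirected; $\Gamma(v)$ is the set of neighbours of $v$. A graph is a Deza graph with parameters $(N,k,b,a)$ if it has $N$ vertices, is $k$-regular, and $|\Gamma(u)\cap\Gamma(v)|\in\{a,b\}$ for any two distinct vertices $u,v$ (no order between $a$ and $b$ is imposed here). If $a\ne b$, its children are the two graphs on the same vertex set in which two distinct vertices are adjacent iff they have exactly $a$ (respectively exactly $b$) common neighbours. A regular graph is edge-regular if any two adjacent vertices have the same number of common neighbours. A graph is strongly regular with parameters $(N,k,\lambda,\mu')$ if it has $N$ vertices, is $k$-regular, any two adjacent vertices have exactly $\lambda$ common neighbours, and any two distinct non-adjacent vertices have exactly $\mu'$ common neighbours. -}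

module Defs where

open import Algebra.Bundles using (CommutativeRing; RawRing)
open import Algebra.Module.Bundles using (LeftModule)
import Algebra.Definitions.RawSemiring as RawSemiringDefinitions
import Algebra.Module.Construct.TensorUnit as TensorUnit
open import Algebra.Module.Morphism.Structures using (module LeftModuleMorphisms)
open import Data.Bool.Base using (if_then_else_)
open import Data.Fin.Base using (Fin; toℕ)
open import Data.Fin.Patterns using (0F; 1F)
open import Data.Fin.Properties using (_≟_; all?; any?)
open import Data.Integer.Base using (ℤ; 0ℤ; 1ℤ; -1ℤ)
open import Data.Nat.Base as ℕ using (ℕ; zero; suc)
open import Data.Nat.DivMod using (_mod_)
open import Data.Product using (Σ; ∃; _×_; _,_; proj₁)
open import Data.Sum using (_⊎_; inj₁; inj₂)
open import Data.Vec.Base using (Vec; []; _∷_; map; zipWith; replicate)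
import Data.Vec.Properties as Vec
open import Function.Bundles using (Inverse; _⇔_)
open import Level using (0ℓ)
open import Relation.Binary.Bundles using (Setoid)
open import Relation.Binary.Core using (Rel)
open import Relation.Binary.Definitions using (Decidable; Irreflexive; Symmetric; _Respects₂_)
open import Relation.Binary.PropositionalEquality as ≡
  using (_≡_; _≢_; refl; trans; cong; cong₂; isEquivalence; setoid)
import Relation.Binary.Construct.On as On
open import Relation.Nullary using (¬_; Dec; does; yes; no; ¬?; _×-dec_; _⊎-dec_)
open import Relation.Nullary.Decidable using (from-yes)

𝔽₅ : Set
𝔽₅ = Fin 5

infixl 6 _+_
infixl 7 _*_
infix  8 -_

_+_ _*_ : 𝔽₅ → 𝔽₅ → 𝔽₅
x + y = (toℕ x ℕ.+ toℕ y) mod 5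
x * y = (toℕ x ℕ.* toℕ y) mod 5

-_ : 𝔽₅ → 𝔽₅
- x = (5 ℕ.∸ toℕ x) mod 5

𝔽₅-commutativeRing : CommutativeRing 0ℓ 0ℓ
𝔽₅-commutativeRing = record
  { Carrier = 𝔽₅
  ; _≈_ = _≡_
  ; _+_ = _+_
  ; _*_ = _*_
  ; -_ = -_
  ; 0# = 0F
  ; 1# = 1F
  ; isCommutativeRing = record
    { isRing = record
      { +-isAbelianGroup = record
        { isGroup = record
          { isMonoid = record
            { isSemigroup = record
              { isMagma = record { isEquivalence = isEquivalence ; ∙-cong = cong₂ _+_ }
              ; assoc = from-yes (all? λ x → all? λ y → all? λ z → ((x + y) + z) ≟ (x + (y + z)))
              }
            ; identity = from-yes (all? λ x → (0F + x) ≟ x)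
                       , from-yes (all? λ x → (x + 0F) ≟ x)
            }
          ; inverse = from-yes (all? λ x → (- x + x) ≟ 0F)
                    , from-yes (all? λ x → (x + - x) ≟ 0F)
          ; ⁻¹-cong = cong -_
          }
        ; comm = from-yes (all? λ x → all? λ y → (x + y) ≟ (y + x))
        }
      ; *-cong = cong₂ _*_
      ; *-assoc = from-yes (all? λ x → all? λ y → all? λ z → ((x * y) * z) ≟ (x * (y * z)))
      ; *-identity = from-yes (all? λ x → (1F * x) ≟ x)
                   , from-yes (all? λ x → (x * 1F) ≟ x)
      ; distrib = from-yes (all? λ x → all? λ y → all? λ z → (x * (y + z)) ≟ (x * y + x * z))
                , from-yes (all? λ x → all? λ y → all? λ z → ((y + z) * x) ≟ (y * x + z * x))
      }
    ; *-comm = from-yes (all? λ x → all? λ y → (x * y) ≟ (y * x))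
    }
  }

open CommutativeRing 𝔽₅-commutativeRing public
  using (ring; rawRing; 0#; 1#)

open RawSemiringDefinitions (RawRing.rawSemiring rawRing) public using (_^_)

2# : 𝔽₅
2# = 1# + 1#

½ : 𝔽₅
½ = 3 mod 5

2*½≡1 : 2# * ½ ≡ 1#
2*½≡1 = refl

-- The quadratic character.
μ : 𝔽₅ → ℤ
μ x with x ≟ 0#
... | yes _ = 0ℤ
... | no  _ with any? (λ y → (y * y) ≟ x)
...   | yes _ = 1ℤ
...   | no  _ = -1ℤ

𝔽₅^ : ℕ → LeftModule ring 0ℓ 0ℓ
𝔽₅^ n = record
  { Carrierᴹ = Vec 𝔽₅ n
  ; _≈ᴹ_ = _≡_
  ; _+ᴹ_ = zipWith _+_
  ; _*ₗ_ = λ a → map (a *_)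
  ; 0ᴹ = replicate n 0#
  ; -ᴹ_ = map -_
  ; isLeftModule = record
    { isLeftSemimodule = record
      { +ᴹ-isCommutativeMonoid = record
        { isMonoid = record
          { isSemigroup = record
            { isMagma = record { isEquivalence = isEquivalence ; ∙-cong = cong₂ (zipWith _+_) }
            ; assoc = Vec.zipWith-assoc F.+-assoc
            }
          ; identity = Vec.zipWith-identityˡ F.+-identityˡ , Vec.zipWith-identityʳ F.+-identityʳ
          }
        ; comm = Vec.zipWith-comm F.+-comm
        }
      ; isPreleftSemimodule = record
        { *ₗ-cong = cong₂ (λ a → map (a *_))
        ; *ₗ-zeroˡ = zeroˡ
        ; *ₗ-distribʳ = distribʳ
        ; *ₗ-identityˡ = λ x → trans (Vec.map-cong F.*-identityˡ x) (Vec.map-id x)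
        ; *ₗ-assoc = λ a b x → trans (Vec.map-cong (F.*-assoc a b) x) (Vec.map-∘ (a *_) (b *_) x)
        ; *ₗ-zeroʳ = λ a → trans (Vec.map-replicate (a *_) 0# n) (cong (replicate n) (F.zeroʳ a))
        ; *ₗ-distribˡ = distribˡ
        }
      }
    ; -ᴹ‿cong = cong (map -_)
    ; -ᴹ‿inverse = Vec.zipWith-inverseˡ F.-‿inverseˡ , Vec.zipWith-inverseʳ F.-‿inverseʳ
    }
  }
  where
  module F = CommutativeRing 𝔽₅-commutativeRing

  zeroˡ : ∀ {m} (x : Vec 𝔽₅ m) → map (0# *_) x ≡ replicate m 0#
  zeroˡ []       = refl
  zeroˡ (x ∷ xs) = cong₂ _∷_ (F.zeroˡ x) (zeroˡ xs)

  distribʳ : ∀ {m} (x : Vec 𝔽₅ m) a b →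
             map ((a + b) *_) x ≡ zipWith _+_ (map (a *_) x) (map (b *_) x)
  distribʳ []       a b = refl
  distribʳ (x ∷ xs) a b = cong₂ _∷_ (F.distribʳ x a b) (distribʳ xs a b)

  distribˡ : ∀ {m} a (x y : Vec 𝔽₅ m) →
             map (a *_) (zipWith _+_ x y) ≡ zipWith _+_ (map (a *_) x) (map (a *_) y)
  distribˡ a []       []       = refl
  distribˡ a (x ∷ xs) (y ∷ ys) = cong₂ _∷_ (F.distribˡ a x y) (distribˡ a xs ys)

module _ {n : ℕ} where
  open LeftModule (𝔽₅^ n) public using (_+ᴹ_; _*ₗ_; 0ᴹ; -ᴹ_)

IsLinearForm : ∀ {n} → (Vec 𝔽₅ n → 𝔽₅) → Set
IsLinearForm {n} = IsLeftModuleHomomorphism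
  where open LeftModuleMorphisms (LeftModule.rawLeftModule (𝔽₅^ n))
                                 (TensorUnit.rawLeftModule {R = rawRing})

IsLinearAutomorphism : ∀ {n} → (Vec 𝔽₅ n → Vec 𝔽₅ n) → Set
IsLinearAutomorphism {n} = IsLeftModuleIsomorphism
  where open LeftModuleMorphisms (LeftModule.rawLeftModule (𝔽₅^ n))
                                 (LeftModule.rawLeftModule (𝔽₅^ n))

polar : ∀ {n} → (Vec 𝔽₅ n → 𝔽₅) → Vec 𝔽₅ n → Vec 𝔽₅ n → 𝔽₅
polar Q x y = ½ * (Q (x +ᴹ y) + - Q x + - Q y)

-- polar is symmetric by construction, so linearity in the second
-- argument gives bilinearity.
record QuadraticForm (n : ℕ) : Set where
  field
    form        : Vec 𝔽₅ n → 𝔽₅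
    homogeneous : ∀ a x → form (a *ₗ x) ≡ (a * a) * form x
    bilinear    : ∀ x → IsLinearForm (polar form x)

  B : Vec 𝔽₅ n → Vec 𝔽₅ n → 𝔽₅
  B = polar form

  Nondegenerate : Set
  Nondegenerate = ∀ x → (∀ y → B x y ≡ 0#) → x ≡ 0ᴹ

_≅_ : ∀ {n} → (Q Q′ : Vec 𝔽₅ n → 𝔽₅) → Set
Q ≅ Q′ = ∃ λ T → IsLinearAutomorphism T × (∀ x → Q (T x) ≡ Q′ x)

-- x₁² + … + xₙ₋₁² + d xₙ²
standardForm : ∀ {n} → 𝔽₅ → Vec 𝔽₅ n → 𝔽₅
standardForm d []            = 0#
standardForm d (x ∷ [])      = d * (x * x)
standardForm d (x ∷ y ∷ xs)  = x * x + standardForm d (y ∷ xs)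

-- The determinant is only determined up to nonzero squares, so it is a
-- relation rather than a function.
IsDet : ∀ {n} → QuadraticForm n → 𝔽₅ → Set
IsDet Q d = d ≢ 0# × QuadraticForm.form Q ≅ standardForm d

HasSize : Setoid 0ℓ 0ℓ → ℕ → Set
HasSize S c = Inverse S (setoid (Fin c))

SubsetHasSize : (V : Setoid 0ℓ 0ℓ) → (Setoid.Carrier V → Set) → ℕ → Set
SubsetHasSize V P = HasSize (On.setoid V (proj₁ {B = P}))

Matrix : Set → Set
Matrix I = I → I → ℕ

infixl 6 _⊕_
_⊕_ : ∀ {I} → Matrix I → Matrix I → Matrix I
(A ⊕ A′) u v = A u v ℕ.+ A′ u v

relationMatrix : {I : Set} {R : Rel I 0ℓ} → Decidable R → Matrix I
relationMatrix R? u v = if does (R? u v) then 1 else 0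

-- Vertices are identified up to the equality of the setoid V; "distinct"
-- always refers to that equality.
record Graph (V : Setoid 0ℓ 0ℓ) : Set₁ where
  open Setoid V using (_≈_; _≉_) renaming (Carrier to Vertex)
  field
    Adj    : Rel Vertex 0ℓ
    adj?   : Decidable Adj
    resp   : Adj Respects₂ _≈_
    sym    : Symmetric Adj
    irrefl : Irreflexive _≈_ Adj
    finite : ∃ (HasSize V)

  ValencyIs : Vertex → ℕ → Set
  ValencyIs v = SubsetHasSize V (Adj v)

  CommonNeighbours : Vertex → Vertex → ℕ → Set
  CommonNeighbours u v = SubsetHasSize V (λ w → Adj u w × Adj v w)

  HasAdjacencyMatrix : Matrix Vertex → Set
  HasAdjacencyMatrix A = ∀ u v → A u v ≡ relationMatrix adj? u v

  Regular : ℕ → Set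
  Regular k = ∀ v → ValencyIs v k

  EdgeRegular : Set
  EdgeRegular = ∃ Regular × ∃ λ l → ∀ u v → Adj u v → CommonNeighbours u v l

  Deza : (N k b a : ℕ) → Set
  Deza N k b a =
    HasSize V N × Regular k ×
    (∀ u v → u ≉ v → CommonNeighbours u v a ⊎ CommonNeighbours u v b)

  StronglyRegular : (N k l m : ℕ) → Set
  StronglyRegular N k l m =
    HasSize V N × Regular k ×
    (∀ u v → Adj u v → CommonNeighbours u v l) ×
    (∀ u v → u ≉ v → ¬ Adj u v → CommonNeighbours u v m)

module _ {V : Setoid 0ℓ 0ℓ} where
  open Setoid V using (_≉_)
  open Graph using (Adj; CommonNeighbours)

  Complementary : Graph V → Graph V → Set
  Complementary Γ Γ′ = ∀ u v → u ≉ v → Adj Γ u v ⇔ (¬ Adj Γ′ u v)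

  IsChild : Graph V → ℕ → Graph V → Set
  IsChild Γ c Γ′ = ∀ u v → u ≉ v → Adj Γ′ u v ⇔ CommonNeighbours Γ u v c

  -- For Γ a Deza graph with parameters (_, _, b, a): Γ′ and Γ″ are its
  -- two children, in either order.
  AreChildren : Graph V → (b a : ℕ) → Graph V → Graph V → Set
  AreChildren Γ b a Γ′ Γ″ =
    a ≢ b ×
    ((IsChild Γ a Γ′ × IsChild Γ b Γ″) ⊎ (IsChild Γ b Γ′ × IsChild Γ a Γ″))

module _ {n : ℕ} (Q : QuadraticForm n) where
  open QuadraticForm Q

  UnitVector : Set
  UnitVector = Σ (Vec 𝔽₅ n) λ v → form v ≡ 1#

  -- An element {v , -v} is given by either representative; the equality
  -- identifies the two.
  _≈±_ : Rel UnitVector 0ℓ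
  (v , _) ≈± (u , _) = v ≡ u ⊎ v ≡ -ᴹ u

  private
    neg-involutive : ∀ {m} (v : Vec 𝔽₅ m) → map -_ (map -_ v) ≡ v
    neg-involutive []       = refl
    neg-involutive (x ∷ xs) =
      cong₂ _∷_ (from-yes (all? λ z → (- (- z)) ≟ z) x) (neg-involutive xs)

  S⁺ : Setoid 0ℓ 0ℓ
  S⁺ = record
    { Carrier = UnitVector
    ; _≈_ = _≈±_
    ; isEquivalence = record
      { refl  = inj₁ refl
      ; sym   = λ { (inj₁ refl) → inj₁ refl
                  ; (inj₂ refl) → inj₂ (≡.sym (neg-involutive _)) }
      ; trans = λ { (inj₁ refl) q           → q
                  ; (inj₂ refl) (inj₁ refl) → inj₂ refl
                  ; (inj₂ refl) (inj₂ refl) → inj₁ (neg-involutive _) }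
      }
    }

  𝓡₀ 𝓡₁ 𝓡₂ : Rel UnitVector 0ℓ
  𝓡₀ (v , _) (u , _)         = B v u ≡ 0#
  𝓡₁ v̂@(v , _) û@(u , _)     = ¬ (v̂ ≈± û) × (B v u ≡ 1# ⊎ B v u ≡ - 1#)
  𝓡₂ (v , _) (u , _)         = B v u ≡ 2# ⊎ B v u ≡ - 2#

  _≈±?_ : Decidable _≈±_
  (v , _) ≈±? (u , _) = Vec.≡-dec _≟_ v u ⊎-dec Vec.≡-dec _≟_ v (-ᴹ u)

  𝓡₀? : Decidable 𝓡₀
  𝓡₀? (v , _) (u , _) = B v u ≟ 0#

  𝓡₁? : Decidable 𝓡₁
  𝓡₁? v̂@(v , _) û@(u , _) = ¬? (v̂ ≈±? û) ×-dec (B v u ≟ 1# ⊎-dec B v u ≟ - 1#)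

  𝓡₂? : Decidable 𝓡₂
  𝓡₂? (v , _) (u , _) = B v u ≟ 2# ⊎-dec B v u ≟ - 2#

  A₀ A₁ A₂ : Matrix UnitVector
  A₀ = relationMatrix 𝓡₀?
  A₁ = relationMatrix 𝓡₁?
  A₂ = relationMatrix 𝓡₂?

{-# OPTIONS --safe #-}

-- For a unit vector v (or two unit vectors v, u with v ≠ ±u) the number of w with Q(w) = 1 and
-- prescribed B(v,w) (and B(u,w)) is found by Radon inversion in the affine space with coordinates
-- (Q(w), B(v,w), B(u,w)): the multiplicity of a point is determined by those of the planes through
-- it.  A plane not parallel to the first axis is, up to translating w by an element of ⟨v,u⟩,
-- a level set of Q; any other plane is a hyperplane of 𝔽₅ⁿ.  With 5ʲ = X, n = 5 + 2j, every count is
-- therefore a multiple of X² plus ε X times a finite character sum over 𝔽₅ that depends only on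
-- B(v,u).

module Submission where

open import Defs using (𝔽₅; 1#; μ; QuadraticForm; IsDet; Graph; Complementary; AreChildren; S⁺; _⊕_; A₀; A₁; A₂)
import Defs as F using (_*_; _^_; -_)
open import Data.Integer using (+_; _+_; _-_; _*_; _^_)
open import Data.Nat using (ℕ; _<_; _∸_; _/_; _%_)
open import Data.Product using (Σ-syntax; ∃-syntax; _×_)
open import Relation.Binary.PropositionalEquality using (_≡_)

open import Defs using (HasSize; SubsetHasSize; _≈±?_; 0#; 2#; ½; rawRing; 𝔽₅^; standardForm; _+ᴹ_; _*ₗ_; 0ᴹ; -ᴹ_)
  renaming (_+_ to _+₅_; _*_ to _*₅_; -_ to -₅_; _^_ to _^₅_)
open import Algebra.Bundles using (AbelianGroup)
import Algebra.Properties.Group as GroupProperties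
open import Algebra.Module.Bundles using (LeftModule)
import Algebra.Module.Construct.TensorUnit as TensorUnit
open import Algebra.Module.Morphism.Structures using (module LeftModuleMorphisms)
open import Data.Bool.Base using (true; false; if_then_else_)
open import Data.Fin.Base using (Fin; zero; suc)
open import Data.Fin.Patterns using (0F; 1F; 2F; 3F; 4F)
open import Data.Fin.Permutation using (↔⇒≡)
open import Data.Fin.Properties using (all?) renaming (_≟_ to _≟₅_)
open import Data.Integer using (ℤ; 0ℤ; 1ℤ; -1ℤ; -_; ∣_∣) renaming (_≟_ to _≟ℤ_)
import Data.Integer.Properties as ℤ
open import Data.Integer.Tactic.RingSolver using (solve-∀)
open import Data.List.Base using (List; []; _∷_; _++_; map; filter; length; lookup; allFin; cartesianProductWith)
open import Data.List.Membership.Propositional using (_∈_)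
import Data.List.Membership.Propositional.Properties as ∈
open import Data.List.Relation.Unary.All as All using (All; []; _∷_)
open import Data.List.Relation.Unary.AllPairs using ([]; _∷_)
open import Data.List.Relation.Unary.Any as Any using (here; there)
import Data.List.Relation.Unary.Any.Properties as Any
open import Data.List.Relation.Unary.Unique.Propositional using (Unique)
import Data.List.Relation.Unary.Unique.Propositional.Properties as Unique
import Data.Nat.Base as ℕ
open import Data.Nat.Base using (zero; suc)
open import Data.Nat.DivMod using (m*n/n≡m; m≡m%n+[m/n]*n)
open import Data.Product using (_,_; proj₁; proj₂)
open import Data.Sum using (_⊎_; inj₁; inj₂)
open import Data.Unit.Base using (⊤; tt)
open import Data.Vec.Base using (Vec; []; _∷_)
import Data.Vec.Properties as Vec
open import Function.Base using (_∘_)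
open import Function.Bundles using (Inverse; _⇔_; mk⇔)
import Function.Construct.Composition as Compose
import Function.Construct.Symmetry as Symmetry
open import Function.Definitions using (Injective; Bijective)
open import Level using (0ℓ)
open import Relation.Binary.Bundles using (Setoid)
import Relation.Binary.Construct.On as On
open import Relation.Binary.PropositionalEquality
  using (_≢_; refl; sym; trans; cong; cong₂; subst; module ≡-Reasoning)
open import Relation.Nullary using (¬_; Dec; yes; no; does; contradiction; ¬?; _×-dec_; _⊎-dec_)
open import Relation.Nullary.Decidable using (from-yes; does-⇔; decidable-stable; _→-dec_)

-- Splitting 𝔽₅ⁿ into ⟨v,u⟩ and its orthogonal complement would break down when B(v,u) = ±1 with v ≠
-- ±u: the Gram determinant 1 - B(v,u)² vanishes and ⟨v,u⟩ is degenerate. Radon inversion asks only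
-- that v and u be linearly independent, so all values of B(v,u) are treated at once. Besides
-- nondegeneracy, the only input on Q is the number of w with Q(w) = y, namely 625X² + 25eμ(y) with
-- e = εX. All planes share the main term 625X²; only μ(y) varies from plane to plane, and its sums
-- are tabulated by evaluation. The sums needed turn out to depend only on whether B(v,u) = 0, which
-- is why two common-neighbour counts occur and why orthogonality and its complement are the
-- children. Vectors are counted rather than classes, so each count is twice the wanted number. The
-- equations are kept over ℤ in this doubled form, since ε may be -1; natural numbers are recovered
-- from the evenness of X² ± e.

private
  variable
    A A′ A″ : Set

-- Sums over lists

∑ : List A → (A → ℤ) → ℤ
∑ []       f = 0ℤ
∑ (x ∷ xs) f = f x + ∑ xs f

∑-cong : ∀ (xs : List A) {f g : A → ℤ} → (∀ x → f x ≡ g x) → ∑ xs f ≡ ∑ xs g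
∑-cong []       f≗g = refl
∑-cong (x ∷ xs) f≗g = cong₂ _+_ (f≗g x) (∑-cong xs f≗g)

∑-distrib-+ : ∀ (xs : List A) (f g : A → ℤ) → ∑ xs (λ x → f x + g x) ≡ ∑ xs f + ∑ xs g
∑-distrib-+ []       f g = refl
∑-distrib-+ (x ∷ xs) f g =
  trans (cong (λ s → f x + g x + s) (∑-distrib-+ xs f g)) (medial (f x) (g x) (∑ xs f) (∑ xs g))
  where
  medial : ∀ a b c d → a + b + (c + d) ≡ a + c + (b + d)
  medial = solve-∀

*-distribˡ-∑ : ∀ (xs : List A) (c : ℤ) (f : A → ℤ) → ∑ xs (λ x → c * f x) ≡ c * ∑ xs f
*-distribˡ-∑ []       c f = sym (ℤ.*-zeroʳ c)
*-distribˡ-∑ (x ∷ xs) c f =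
  trans (cong (λ s → c * f x + s) (*-distribˡ-∑ xs c f)) (sym (ℤ.*-distribˡ-+ c (f x) (∑ xs f)))

∑-zero : ∀ (xs : List A) → ∑ xs (λ _ → 0ℤ) ≡ 0ℤ
∑-zero []       = refl
∑-zero (x ∷ xs) = trans (ℤ.+-identityˡ _) (∑-zero xs)

∑-const : ∀ (xs : List A) (c : ℤ) → ∑ xs (λ _ → c) ≡ c * ∑ xs (λ _ → 1ℤ)
∑-const xs c =
  trans (∑-cong xs (λ _ → sym (ℤ.*-identityʳ c))) (*-distribˡ-∑ xs c (λ _ → 1ℤ))

∑-affine : ∀ (xs : List A) (a c : ℤ) (f : A → ℤ) →
           ∑ xs (λ x → a + c * f x) ≡ a * ∑ xs (λ _ → 1ℤ) + c * ∑ xs f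
∑-affine xs a c f =
  trans (∑-distrib-+ xs (λ _ → a) (λ x → c * f x)) (cong₂ _+_ (∑-const xs a) (*-distribˡ-∑ xs c f))

∑-comm : ∀ (xs : List A) (ys : List A′) (f : A → A′ → ℤ) →
         ∑ xs (λ x → ∑ ys (f x)) ≡ ∑ ys (λ y → ∑ xs (λ x → f x y))
∑-comm []       ys f = sym (∑-zero ys)
∑-comm (x ∷ xs) ys f =
  trans (cong (λ s → ∑ ys (f x) + s) (∑-comm xs ys f))
        (sym (∑-distrib-+ ys (f x) (λ y → ∑ xs (λ x′ → f x′ y))))

∑-++ : ∀ (xs ys : List A) (f : A → ℤ) → ∑ (xs ++ ys) f ≡ ∑ xs f + ∑ ys f
∑-++ []       ys f = sym (ℤ.+-identityˡ _)
∑-++ (x ∷ xs) ys f = trans (cong (λ s → f x + s) (∑-++ xs ys f)) (sym (ℤ.+-assoc (f x) _ _))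

∑-map : ∀ (g : A → A′) (xs : List A) (f : A′ → ℤ) → ∑ (map g xs) f ≡ ∑ xs (f ∘ g)
∑-map g []       f = refl
∑-map g (x ∷ xs) f = cong (λ s → f (g x) + s) (∑-map g xs f)

∑-cartesianProductWith : ∀ (g : A → A′ → A″) (xs : List A) (ys : List A′) (f : A″ → ℤ) →
  ∑ (cartesianProductWith g xs ys) f ≡ ∑ xs (λ x → ∑ ys (λ y → f (g x y)))
∑-cartesianProductWith g []       ys f = refl
∑-cartesianProductWith g (x ∷ xs) ys f =
  trans (∑-++ (map (g x) ys) _ f)
        (cong₂ _+_ (∑-map (g x) ys f) (∑-cartesianProductWith g xs ys f))

-- Indicators of decidable propositions, and sums against them

⟦_⟧ : {P : Set} → Dec P → ℤ
⟦ P? ⟧ = if does P? then 1ℤ else 0ℤ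

⟦⟧-cong : {P Q : Set} {P? : Dec P} {Q? : Dec Q} → P ⇔ Q → ⟦ P? ⟧ ≡ ⟦ Q? ⟧
⟦⟧-cong {P? = P?} {Q?} P⇔Q = cong (if_then 1ℤ else 0ℤ) (does-⇔ P⇔Q P? Q?)

⟦⟧-true : {P : Set} (P? : Dec P) → P → ⟦ P? ⟧ ≡ 1ℤ
⟦⟧-true (yes _) p = refl
⟦⟧-true (no ¬p) p = contradiction p ¬p

⟦⟧-false : {P : Set} (P? : Dec P) → ¬ P → ⟦ P? ⟧ ≡ 0ℤ
⟦⟧-false (yes p) ¬p = contradiction p ¬p
⟦⟧-false (no _)  ¬p = refl

⟦⟧-× : {P Q : Set} (P? : Dec P) (Q? : Dec Q) → ⟦ P? ×-dec Q? ⟧ ≡ ⟦ P? ⟧ * ⟦ Q? ⟧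
⟦⟧-× (yes _) (yes _) = refl
⟦⟧-× (yes _) (no _)  = refl
⟦⟧-× (no _)  (yes _) = refl
⟦⟧-× (no _)  (no _)  = refl

length-filter : {P : A → Set} (P? : ∀ x → Dec (P x)) (xs : List A) →
                + length (filter P? xs) ≡ ∑ xs (λ x → ⟦ P? x ⟧)
length-filter P? []       = refl
length-filter P? (x ∷ xs) with does (P? x)
... | true  = cong (λ s → 1ℤ + s) (length-filter P? xs)
... | false = trans (length-filter P? xs) (sym (ℤ.+-identityˡ _))

module _ (_≟_ : (x y : A) → Dec (x ≡ y)) where

  ∑-δ∉ : ∀ {a} {xs : List A} → All (a ≢_) xs → (f : A → ℤ) → ∑ xs (λ x → ⟦ x ≟ a ⟧ * f x) ≡ 0ℤ
  ∑-δ∉ []             f = refl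
  ∑-δ∉ (a≢x ∷ a∉xs) f =
    cong₂ _+_ (cong (_* f _) (⟦⟧-false (_ ≟ _) (a≢x ∘ sym))) (∑-δ∉ a∉xs f)

  ∑-δ : ∀ {a} {xs : List A} → Unique xs → a ∈ xs → (f : A → ℤ) → ∑ xs (λ x → ⟦ x ≟ a ⟧ * f x) ≡ f a
  ∑-δ {a} (a∉xs ∷ _) (here refl) f =
    trans (cong₂ _+_ (trans (cong (_* f a) (⟦⟧-true (a ≟ a) refl)) (ℤ.*-identityˡ (f a))) (∑-δ∉ a∉xs f))
          (ℤ.+-identityʳ (f a))
  ∑-δ {a} (x∉xs ∷ xs!) (there a∈xs) f =
    trans (cong₂ _+_ (cong (_* f _) (⟦⟧-false (_ ≟ a) (All.lookup x∉xs a∈xs))) (∑-δ xs! a∈xs f))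
          (ℤ.+-identityˡ (f a))

∑-linear : ∀ (xs : List A) (a c : ℤ) (f g : A → ℤ) →
           ∑ xs (λ x → a * f x + c * g x) ≡ a * ∑ xs f + c * ∑ xs g
∑-linear xs a c f g =
  trans (∑-distrib-+ xs (λ x → a * f x) (λ x → c * g x))
        (cong₂ _+_ (*-distribˡ-∑ xs a f) (*-distribˡ-∑ xs c g))

-- Sums over 𝔽₅ and over 𝔽₅ⁿ

-- Opaque so that unification can read off the dimension from the list.
opaque
  vectors : ∀ n → List (Vec 𝔽₅ n)
  vectors zero    = [] ∷ []
  vectors (suc n) = cartesianProductWith _∷_ (allFin 5) (vectors n)

  ∈-vectors : ∀ {n} (v : Vec 𝔽₅ n) → v ∈ vectors n
  ∈-vectors []      = here refl
  ∈-vectors (x ∷ v) = ∈.∈-cartesianProductWith⁺ _∷_ (∈.∈-allFin x) (∈-vectors v)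

  vectors-unique : ∀ n → Unique (vectors n)
  vectors-unique zero    = [] ∷ []
  vectors-unique (suc n) =
    Unique.cartesianProductWith⁺ _∷_ Vec.∷-injective (Unique.allFin⁺ 5) (vectors-unique n)

  ∑-vectors-zero : (f : Vec 𝔽₅ 0 → ℤ) → ∑ (vectors 0) f ≡ f []
  ∑-vectors-zero f = ℤ.+-identityʳ (f [])

  ∑-vectors-suc : ∀ n (f : Vec 𝔽₅ (suc n) → ℤ) →
    ∑ (vectors (suc n)) f ≡ ∑ (allFin 5) (λ x → ∑ (vectors n) (λ v → f (x ∷ v)))
  ∑-vectors-suc n = ∑-cartesianProductWith _∷_ (allFin 5) (vectors n)

_≟ᵛ_ : ∀ {n} (v w : Vec 𝔽₅ n) → Dec (v ≡ w)
_≟ᵛ_ = Vec.≡-dec _≟₅_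

∑₅ : (𝔽₅ → ℤ) → ℤ
∑₅ = ∑ (allFin 5)

∑ᵛ : ∀ {n} → (Vec 𝔽₅ n → ℤ) → ℤ
∑ᵛ {n} = ∑ (vectors n)

∑₅-δ : ∀ a (f : 𝔽₅ → ℤ) → ∑₅ (λ x → ⟦ x ≟₅ a ⟧ * f x) ≡ f a
∑₅-δ a = ∑-δ _≟₅_ (Unique.allFin⁺ 5) (∈.∈-allFin a)

∑ᵛ-δ : ∀ {n} a (f : Vec 𝔽₅ n → ℤ) → ∑ᵛ (λ x → ⟦ x ≟ᵛ a ⟧ * f x) ≡ f a
∑ᵛ-δ a = ∑-δ _≟ᵛ_ (vectors-unique _) (∈-vectors a)

∑ᵛ-one : ∀ n → ∑ᵛ {n} (λ _ → 1ℤ) ≡ (+ 5) ^ n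
∑ᵛ-one zero    = ∑-vectors-zero (λ _ → 1ℤ)
∑ᵛ-one (suc n) = begin
  ∑ᵛ (λ _ → 1ℤ)               ≡⟨ ∑-vectors-suc n (λ _ → 1ℤ) ⟩
  ∑₅ (λ _ → ∑ᵛ {n} (λ _ → 1ℤ)) ≡⟨ ∑-const (allFin 5) (∑ᵛ {n} (λ _ → 1ℤ)) ⟩
  ∑ᵛ {n} (λ _ → 1ℤ) * + 5       ≡⟨ ℤ.*-comm (∑ᵛ {n} (λ _ → 1ℤ)) (+ 5) ⟩
  + 5 * ∑ᵛ {n} (λ _ → 1ℤ)       ≡⟨ cong (+ 5 *_) (∑ᵛ-one n) ⟩
  (+ 5) ^ suc n                ∎
  where open ≡-Reasoning

-- Each `f (T x)` is expanded as a delta sum over y. After the two sums are interchanged, y = Tx is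
-- read as x = T⁻¹y, and the sum over x collapses.
∑ᵛ-reindex : ∀ {n} {T : Vec 𝔽₅ n → Vec 𝔽₅ n} → Bijective _≡_ _≡_ T →
             (f : Vec 𝔽₅ n → ℤ) → ∑ᵛ (λ x → f (T x)) ≡ ∑ᵛ f
∑ᵛ-reindex {n} {T} (injective , surjective) f = begin
  ∑ᵛ (λ x → f (T x))
    ≡⟨ ∑-cong V (λ x → sym (∑ᵛ-δ (T x) f)) ⟩
  ∑ᵛ (λ x → ∑ᵛ (λ y → ⟦ y ≟ᵛ T x ⟧ * f y))
    ≡⟨ ∑-comm V V _ ⟩
  ∑ᵛ (λ y → ∑ᵛ (λ x → ⟦ y ≟ᵛ T x ⟧ * f y))
    ≡⟨ ∑-cong V (λ y → ∑-cong V (λ x →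
         cong (_* f y) (⟦⟧-cong {P? = y ≟ᵛ T x} {x ≟ᵛ T⁻¹ y} (mk⇔ (to y x) (from y x))))) ⟩
  ∑ᵛ (λ y → ∑ᵛ (λ x → ⟦ x ≟ᵛ T⁻¹ y ⟧ * f y))
    ≡⟨ ∑-cong V (λ y → ∑ᵛ-δ (T⁻¹ y) (λ _ → f y)) ⟩
  ∑ᵛ f ∎
  where
  open ≡-Reasoning
  V = vectors n

  T⁻¹ : Vec 𝔽₅ n → Vec 𝔽₅ n
  T⁻¹ y = proj₁ (surjective y)

  to : ∀ y x → y ≡ T x → x ≡ T⁻¹ y
  to y x y≡Tx = injective (trans (sym y≡Tx) (sym (proj₂ (surjective y) refl)))

  from : ∀ y x → x ≡ T⁻¹ y → y ≡ T x
  from y x x≡T⁻¹y = sym (proj₂ (surjective y) x≡T⁻¹y)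

-- The number of representations by the standard form

-- In 𝔽₅ the element -1 = 2² is a square. Hence the factor (-1)^((n-1)/2) has no effect on ε, which
-- is simply μ(d).
μ-*ˡ-neg : ∀ x y → μ ((-₅ 1# *₅ x) *₅ y) ≡ μ (x *₅ y)
μ-*ˡ-neg = from-yes (all? λ x → all? λ y → μ ((-₅ 1# *₅ x) *₅ y) ≟ℤ μ (x *₅ y))

μ-neg1^-* : ∀ k d → μ ((-₅ 1#) ^₅ k *₅ d) ≡ μ d
μ-neg1^-* zero    d = cong μ (from-yes (all? λ x → (1# *₅ x) ≟₅ x) d)
μ-neg1^-* (suc k) d = trans (μ-*ˡ-neg ((-₅ 1#) ^₅ k) d) (μ-neg1^-* k d)

-- Induction removes two variables at a time, which keeps the dimension odd. The base case says that
-- dx² = y has 1 + μ(d)μ(y) solutions. In the step, x² + z² takes the value 0 nine times and every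
-- other value four times, and μ sums to 0 over 𝔽₅, so averaging μ over y - x² - z² leaves 9μ(y) -
-- 4μ(y) = 5μ(y).
count-standardForm : ∀ m d → d ≢ 0# → ∀ y →
  ∑ᵛ (λ w → ⟦ standardForm {suc (m ℕ.* 2)} d w ≟₅ y ⟧)
    ≡ (+ 5) ^ m * (+ 5) ^ m + (+ 5) ^ m * (μ d * μ y)
count-standardForm zero d d≢0 y = begin
  ∑ᵛ (λ w → ⟦ standardForm d w ≟₅ y ⟧)
    ≡⟨ ∑-vectors-suc 0 (λ w → ⟦ standardForm d w ≟₅ y ⟧) ⟩
  ∑₅ (λ x → ∑ᵛ {0} (λ w → ⟦ standardForm d (x ∷ w) ≟₅ y ⟧))
    ≡⟨ ∑-cong (allFin 5) (λ x → ∑-vectors-zero (λ w → ⟦ standardForm d (x ∷ w) ≟₅ y ⟧)) ⟩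
  ∑₅ (λ x → ⟦ (d *₅ (x *₅ x)) ≟₅ y ⟧)
    ≡⟨ base d y d≢0 ⟩
  1ℤ + μ d * μ y
    ≡⟨ cong (λ s → 1ℤ + s) (ℤ.*-identityˡ (μ d * μ y)) ⟨
  1ℤ + 1ℤ * (μ d * μ y) ∎
  where
  open ≡-Reasoning

  base : ∀ d y → d ≢ 0# → ∑₅ (λ x → ⟦ (d *₅ (x *₅ x)) ≟₅ y ⟧) ≡ 1ℤ + μ d * μ y
  base = from-yes (all? λ d → all? λ y → ¬? (d ≟₅ 0#) →-dec
           (∑₅ (λ x → ⟦ (d *₅ (x *₅ x)) ≟₅ y ⟧) ≟ℤ (1ℤ + μ d * μ y)))
count-standardForm (suc m) d d≢0 y = begin
  ∑ᵛ (λ w → ⟦ standardForm d w ≟₅ y ⟧)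
    ≡⟨ ∑-vectors-suc (suc (suc (m ℕ.* 2))) (λ w → ⟦ standardForm d w ≟₅ y ⟧) ⟩
  ∑₅ (λ x → ∑ᵛ {suc (suc (m ℕ.* 2))} (λ w → ⟦ standardForm d (x ∷ w) ≟₅ y ⟧))
    ≡⟨ ∑-cong (allFin 5) (λ x → ∑-vectors-suc (suc (m ℕ.* 2)) (λ w → ⟦ standardForm d (x ∷ w) ≟₅ y ⟧)) ⟩
  ∑₅ (λ x → ∑₅ (λ z → ∑ᵛ {suc (m ℕ.* 2)} (λ w → ⟦ standardForm d (x ∷ z ∷ w) ≟₅ y ⟧)))
    ≡⟨ ∑-cong (allFin 5) (λ x → ∑-cong (allFin 5) (λ z →
         trans (∑-cong (vectors (suc (m ℕ.* 2))) (split x z))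
               (count-standardForm m d d≢0 (rest x z)))) ⟩
  ∑₅ (λ x → ∑₅ (λ z → P * P + P * (μ d * μ (rest x z))))
    ≡⟨ ∑-cong (allFin 5) (λ x → trans
         (∑-cong (allFin 5) (λ z → cong (λ s → P * P + s) (sym (ℤ.*-assoc P (μ d) (μ (rest x z))))))
         (∑-affine (allFin 5) (P * P) (P * μ d) (λ z → μ (rest x z)))) ⟩
  ∑₅ (λ x → P * P * + 5 + P * μ d * ∑₅ (λ z → μ (rest x z)))
    ≡⟨ ∑-affine (allFin 5) (P * P * + 5) (P * μ d) (λ x → ∑₅ (λ z → μ (rest x z))) ⟩
  P * P * + 5 * + 5 + P * μ d * ∑₅ (λ x → ∑₅ (λ z → μ (rest x z)))
    ≡⟨ cong (λ S → P * P * + 5 * + 5 + P * μ d * S) (hyperbolic y) ⟩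
  P * P * + 5 * + 5 + P * μ d * (+ 5 * μ y)
    ≡⟨ regroup P (μ d) (μ y) ⟩
  + 5 * P * (+ 5 * P) + + 5 * P * (μ d * μ y) ∎
  where
  open ≡-Reasoning
  P = (+ 5) ^ m

  rest : 𝔽₅ → 𝔽₅ → 𝔽₅
  rest x z = y +₅ -₅ (x *₅ x +₅ z *₅ z)

  move : ∀ a b y → ((a +₅ b) ≡ y → b ≡ y +₅ -₅ a) × (b ≡ y +₅ -₅ a → (a +₅ b) ≡ y)
  move = from-yes (all? λ a → all? λ b → all? λ y →
    (((a +₅ b) ≟₅ y) →-dec (b ≟₅ (y +₅ -₅ a))) ×-dec ((b ≟₅ (y +₅ -₅ a)) →-dec ((a +₅ b) ≟₅ y)))

  +₅-assoc : ∀ a b c → (a +₅ (b +₅ c)) ≡ ((a +₅ b) +₅ c)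
  +₅-assoc = from-yes (all? λ a → all? λ b → all? λ c → (a +₅ (b +₅ c)) ≟₅ ((a +₅ b) +₅ c))

  split : ∀ x z (w : Vec 𝔽₅ (suc (m ℕ.* 2))) →
          ⟦ standardForm d (x ∷ z ∷ w) ≟₅ y ⟧ ≡ ⟦ standardForm d w ≟₅ rest x z ⟧
  split x z w@(_ ∷ _) = trans
    (cong (λ q → ⟦ q ≟₅ y ⟧) (+₅-assoc (x *₅ x) (z *₅ z) (standardForm d w)))
    (⟦⟧-cong {P? = ((x *₅ x +₅ z *₅ z) +₅ standardForm d w) ≟₅ y} {standardForm d w ≟₅ rest x z}
      (mk⇔ (proj₁ (move (x *₅ x +₅ z *₅ z) (standardForm d w) y))
           (proj₂ (move (x *₅ x +₅ z *₅ z) (standardForm d w) y))))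

  -- As -1 is a square, x² + z² is a hyperbolic plane.
  hyperbolic : ∀ y → ∑₅ (λ x → ∑₅ (λ z → μ (y +₅ -₅ (x *₅ x +₅ z *₅ z)))) ≡ + 5 * μ y
  hyperbolic = from-yes (all? λ y → ∑₅ (λ x → ∑₅ (λ z → μ (y +₅ -₅ (x *₅ x +₅ z *₅ z)))) ≟ℤ (+ 5 * μ y))

  regroup : ∀ P δ ν → P * P * + 5 * + 5 + P * δ * (+ 5 * ν) ≡ + 5 * P * (+ 5 * P) + + 5 * P * (δ * ν)
  regroup = solve-∀

-- Quadratic forms over 𝔽₅

-- Splitting into identities in three and four variables keeps the exhaustive checks small; a direct
-- check would range over 5⁶ cases.
*₅-distrib-differences : ∀ b c s t s′ t′ →
  b *₅ (s′ +₅ -₅ s) +₅ c *₅ (t′ +₅ -₅ t) ≡ (b *₅ s′ +₅ c *₅ t′) +₅ -₅ (b *₅ s +₅ c *₅ t)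
*₅-distrib-differences b c s t s′ t′ =
  trans (cong₂ _+₅_ (distrib b s s′) (distrib c t t′)) (medial (b *₅ s′) (b *₅ s) (c *₅ t′) (c *₅ t))
  where
  distrib : ∀ b s s′ → b *₅ (s′ +₅ -₅ s) ≡ b *₅ s′ +₅ -₅ (b *₅ s)
  distrib = from-yes (all? λ b → all? λ s → all? λ s′ →
              (b *₅ (s′ +₅ -₅ s)) ≟₅ (b *₅ s′ +₅ -₅ (b *₅ s)))

  medial : ∀ a a′ c c′ → (a +₅ -₅ a′) +₅ (c +₅ -₅ c′) ≡ (a +₅ c) +₅ -₅ (a′ +₅ c′)
  medial = from-yes (all? λ a → all? λ a′ → all? λ c → all? λ c′ →
             ((a +₅ -₅ a′) +₅ (c +₅ -₅ c′)) ≟₅ ((a +₅ c) +₅ -₅ (a′ +₅ c′)))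

⟦-≟0⟧ : ∀ a b → ⟦ (a +₅ -₅ b) ≟₅ 0# ⟧ ≡ ⟦ a ≟₅ b ⟧
⟦-≟0⟧ = from-yes (all? λ a → all? λ b → ⟦ (a +₅ -₅ b) ≟₅ 0# ⟧ ≟ℤ ⟦ a ≟₅ b ⟧)

module Form {n : ℕ} (Q : QuadraticForm n) where
  open QuadraticForm Q renaming (form to q)
  module V = LeftModule (𝔽₅^ n)
  module LinearForm = LeftModuleMorphisms V.rawLeftModule (TensorUnit.rawLeftModule {R = rawRing})

  B-+ : ∀ x y z → B x (y +ᴹ z) ≡ B x y +₅ B x z
  B-+ x = IsLinear.+ᴹ-homo
    where module IsLinear = LinearForm.IsLeftModuleHomomorphism (bilinear x)

  B-* : ∀ x a y → B x (a *ₗ y) ≡ a *₅ B x y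
  B-* x = IsLinear.*ₗ-homo
    where module IsLinear = LinearForm.IsLeftModuleHomomorphism (bilinear x)

  B-sym : ∀ x y → B x y ≡ B y x
  B-sym x y = trans (cong (λ z → ½ *₅ (q z +₅ -₅ q x +₅ -₅ q y)) (V.+ᴹ-comm x y))
                    (swap (q (y +ᴹ x)) (q x) (q y))
    where
    swap : ∀ a b c → ½ *₅ (a +₅ -₅ b +₅ -₅ c) ≡ ½ *₅ (a +₅ -₅ c +₅ -₅ b)
    swap = from-yes (all? λ a → all? λ b → all? λ c →
             (½ *₅ (a +₅ -₅ b +₅ -₅ c)) ≟₅ (½ *₅ (a +₅ -₅ c +₅ -₅ b)))

  q-+ : ∀ x y → q (x +ᴹ y) ≡ q x +₅ q y +₅ 2# *₅ B x y
  q-+ x y = depolarize (q (x +ᴹ y)) (q x) (q y)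
    where
    depolarize : ∀ a b c → a ≡ b +₅ c +₅ 2# *₅ (½ *₅ (a +₅ -₅ b +₅ -₅ c))
    depolarize = from-yes (all? λ a → all? λ b → all? λ c →
                   a ≟₅ (b +₅ c +₅ 2# *₅ (½ *₅ (a +₅ -₅ b +₅ -₅ c))))

  q-0 : q 0ᴹ ≡ 0#
  q-0 = trans (cong q (sym (V.*ₗ-zeroʳ 0#)))
              (trans (homogeneous 0# 0ᴹ) (from-yes (all? λ x → ((0# *₅ 0#) *₅ x) ≟₅ 0#) (q 0ᴹ)))

  B-diagonal : ∀ x → B x x ≡ q x
  B-diagonal x =
    trans (cong (λ z → ½ *₅ (z +₅ -₅ q x +₅ -₅ q x))
                (trans (cong q (trans (cong₂ _+ᴹ_ (sym (V.*ₗ-identityˡ x)) (sym (V.*ₗ-identityˡ x)))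
                                      (sym (V.*ₗ-distribʳ x 1# 1#))))
                       (homogeneous 2# x)))
          (from-yes (all? λ a → (½ *₅ ((2# *₅ 2#) *₅ a +₅ -₅ a +₅ -₅ a)) ≟₅ a) (q x))

  -ᴹ≡-1*ₗ : ∀ (x : Vec 𝔽₅ n) → -ᴹ x ≡ (-₅ 1#) *ₗ x
  -ᴹ≡-1*ₗ = Vec.map-cong (from-yes (all? λ a → (-₅ a) ≟₅ (-₅ 1# *₅ a)))

  -ᴹ-involutive : ∀ (x : Vec 𝔽₅ n) → -ᴹ (-ᴹ x) ≡ x
  -ᴹ-involutive = GroupProperties.⁻¹-involutive (AbelianGroup.group V.+ᴹ-abelianGroup)

  q-neg : ∀ x → q (-ᴹ x) ≡ q x
  q-neg x = trans (cong q (-ᴹ≡-1*ₗ x)) (trans (homogeneous (-₅ 1#) x)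
              (from-yes (all? λ a → ((-₅ 1# *₅ -₅ 1#) *₅ a) ≟₅ a) (q x)))

  B-negʳ : ∀ x y → B x (-ᴹ y) ≡ -₅ B x y
  B-negʳ x y = trans (cong (B x) (-ᴹ≡-1*ₗ y)) (trans (B-* x (-₅ 1#) y)
                 (from-yes (all? λ a → (-₅ 1# *₅ a) ≟₅ (-₅ a)) (B x y)))

  B-negˡ : ∀ x y → B (-ᴹ x) y ≡ -₅ B x y
  B-negˡ x y = trans (B-sym (-ᴹ x) y) (trans (B-negʳ y x) (cong -₅_ (B-sym y x)))

  combination : 𝔽₅ → 𝔽₅ → Vec 𝔽₅ n → Vec 𝔽₅ n → Vec 𝔽₅ n
  combination b c v u = (b *ₗ v) +ᴹ (c *ₗ u)

  B-combination : ∀ b c v u w → B w (combination b c v u) ≡ b *₅ B v w +₅ c *₅ B u w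
  B-combination b c v u w = trans (B-+ w (b *ₗ v) (c *ₗ u)) (cong₂ _+₅_
    (trans (B-* w b v) (cong (b *₅_) (B-sym w v)))
    (trans (B-* w c u) (cong (c *₅_) (B-sym w u))))

  -- The right-hand side stays unsimplified: once the values of q at v and u are substituted, it is
  -- literally the summand inside the character sums.
  q-combination : ∀ b c v u → q (combination b c v u) ≡
    (b *₅ b) *₅ q v +₅ (c *₅ c) *₅ q u +₅ 2# *₅ (c *₅ (b *₅ B v u))
  q-combination b c v u = trans (q-+ (b *ₗ v) (c *ₗ u)) (cong₂ _+₅_
    (cong₂ _+₅_ (homogeneous b v) (homogeneous c u))
    (cong (2# *₅_) (trans (B-* (b *ₗ v) c u) (cong (c *₅_)
      (trans (B-sym (b *ₗ v) u) (trans (B-* u b v) (cong (b *₅_) (B-sym u v))))))))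

  ∑ᵛ-translate : ∀ x (f : Vec 𝔽₅ n → ℤ) → ∑ᵛ (λ w → f (w +ᴹ x)) ≡ ∑ᵛ f
  ∑ᵛ-translate x = ∑ᵛ-reindex
    ( (λ {y} {z} → ∙-cancelʳ x y z)
    , λ y → (y +ᴹ -ᴹ x) , λ { refl → //-rightDividesˡ x y })
    where open GroupProperties (AbelianGroup.group V.+ᴹ-abelianGroup)

  ∑ᵛ-negate : ∀ (f : Vec 𝔽₅ n → ℤ) → ∑ᵛ (λ w → f (-ᴹ w)) ≡ ∑ᵛ f
  ∑ᵛ-negate = ∑ᵛ-reindex
    ( (λ {y} {z} e → trans (sym (-ᴹ-involutive y)) (trans (cong -ᴹ_ e) (-ᴹ-involutive z)))
    , λ y → (-ᴹ y) , λ { refl → -ᴹ-involutive y })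

  represent : 𝔽₅ → ℤ
  represent y = ∑ᵛ (λ w → ⟦ q w ≟₅ y ⟧)

  hyperplane : Vec 𝔽₅ n → 𝔽₅ → ℤ
  hyperplane x c = ∑ᵛ (λ w → ⟦ B x w ≟₅ c ⟧)

  -- Some y has B(x,y) ≠ 0, and then every line in direction y meets the hyperplane in exactly one
  -- point. Summing over the five translates by multiples of y therefore counts every vector once.
  hyperplane-≢0 : Nondegenerate → ∀ x → x ≢ 0ᴹ → ∀ c → + 5 * hyperplane x c ≡ (+ 5) ^ n
  hyperplane-≢0 nondegenerate x x≢0 c =
    -- The goal is a decidable equation, so it may be refuted instead of proved: were it false, no y
    -- could be transversal, and nondegeneracy would force x = 0. This avoids searching for y.
    decidable-stable (_ ≟ℤ _) λ ¬goal → x≢0 (nondegenerate x λ y →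
      decidable-stable (_ ≟₅ _) λ Bxy≢0 → ¬goal (transversal y Bxy≢0))
    where
    open ≡-Reasoning

    line : ∀ e → e ≢ 0# → ∀ c b → ∑₅ (λ a → ⟦ (b +₅ a *₅ e) ≟₅ c ⟧) ≡ 1ℤ
    line = from-yes (all? λ e → ¬? (e ≟₅ 0#) →-dec all? λ c → all? λ b →
             ∑₅ (λ a → ⟦ (b +₅ a *₅ e) ≟₅ c ⟧) ≟ℤ 1ℤ)

    transversal : ∀ y → B x y ≢ 0# → + 5 * hyperplane x c ≡ (+ 5) ^ n
    transversal y Bxy≢0 = begin
      + 5 * hyperplane x c
        ≡⟨ ℤ.*-comm (+ 5) (hyperplane x c) ⟩
      hyperplane x c * + 5
        ≡⟨ ∑-const (allFin 5) (hyperplane x c) ⟨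
      ∑₅ (λ _ → hyperplane x c)
        ≡⟨ ∑-cong (allFin 5) (λ a → sym (∑ᵛ-translate (a *ₗ y) (λ w → ⟦ B x w ≟₅ c ⟧))) ⟩
      ∑₅ (λ a → ∑ᵛ (λ w → ⟦ B x (w +ᴹ (a *ₗ y)) ≟₅ c ⟧))
        ≡⟨ ∑-comm (allFin 5) (vectors n) (λ a w → ⟦ B x (w +ᴹ (a *ₗ y)) ≟₅ c ⟧) ⟩
      ∑ᵛ (λ w → ∑₅ (λ a → ⟦ B x (w +ᴹ (a *ₗ y)) ≟₅ c ⟧))
        ≡⟨ ∑-cong (vectors n) (λ w → trans
             (∑-cong (allFin 5) (λ a → cong (λ z → ⟦ z ≟₅ c ⟧)
               (trans (B-+ x w (a *ₗ y)) (cong (B x w +₅_) (B-* x a y)))))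
             (line (B x y) Bxy≢0 c (B x w))) ⟩
      ∑ᵛ {n} (λ _ → 1ℤ)
        ≡⟨ ∑ᵛ-one n ⟩
      (+ 5) ^ n ∎

  -- The translate by x = bv + cu turns a level set of q into the plane through (1, s, t)
  -- with normal (1, 2b, 2c) in the coordinates (q w, B v w, B u w).
  plane : ∀ b c v u s t →
    ∑ᵛ (λ w → ⟦ ((q w +₅ -₅ 1#) +₅ 2# *₅ (b *₅ (B v w +₅ -₅ s) +₅ c *₅ (B u w +₅ -₅ t))) ≟₅ 0# ⟧)
      ≡ represent (1# +₅ 2# *₅ (b *₅ s +₅ c *₅ t) +₅ q (combination b c v u))
  plane b c v u s t = trans
    (∑-cong (vectors n) (λ w → trans
      (⟦⟧-cong {P? = _ ≟₅ 0#} {(q w +₅ q x +₅ 2# *₅ (b *₅ B v w +₅ c *₅ B u w)) ≟₅ y} (equations w))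
      (cong (λ z → ⟦ z ≟₅ y ⟧)
        (trans (cong (λ z → q w +₅ q x +₅ 2# *₅ z) (sym (B-combination b c v u w))) (sym (q-+ w x))))))
    (∑ᵛ-translate x (λ w → ⟦ q w ≟₅ y ⟧))
    where
    x = combination b c v u
    y = 1# +₅ 2# *₅ (b *₅ s +₅ c *₅ t) +₅ q x

    move : ∀ a k p p′ →
      ((a +₅ -₅ 1#) +₅ 2# *₅ (p +₅ -₅ p′) ≡ 0# → a +₅ k +₅ 2# *₅ p ≡ 1# +₅ 2# *₅ p′ +₅ k) ×
      (a +₅ k +₅ 2# *₅ p ≡ 1# +₅ 2# *₅ p′ +₅ k → (a +₅ -₅ 1#) +₅ 2# *₅ (p +₅ -₅ p′) ≡ 0#)
    move = from-yes (all? λ a → all? λ k → all? λ p → all? λ p′ →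
      ((((a +₅ -₅ 1#) +₅ 2# *₅ (p +₅ -₅ p′)) ≟₅ 0#) →-dec ((a +₅ k +₅ 2# *₅ p) ≟₅ (1# +₅ 2# *₅ p′ +₅ k)))
      ×-dec
      (((a +₅ k +₅ 2# *₅ p) ≟₅ (1# +₅ 2# *₅ p′ +₅ k)) →-dec (((a +₅ -₅ 1#) +₅ 2# *₅ (p +₅ -₅ p′)) ≟₅ 0#)))

    equations : ∀ w →
      ((q w +₅ -₅ 1#) +₅ 2# *₅ (b *₅ (B v w +₅ -₅ s) +₅ c *₅ (B u w +₅ -₅ t)) ≡ 0#) ⇔
      (q w +₅ q x +₅ 2# *₅ (b *₅ B v w +₅ c *₅ B u w) ≡ y)
    equations w = mk⇔
      (λ e → proj₁ (move (q w) (q x) p p′) (trans (cong (λ z → (q w +₅ -₅ 1#) +₅ 2# *₅ z) (sym collect)) e))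
      (λ e → trans (cong (λ z → (q w +₅ -₅ 1#) +₅ 2# *₅ z) collect) (proj₂ (move (q w) (q x) p p′) e))
      where
      p  = b *₅ B v w +₅ c *₅ B u w
      p′ = b *₅ s +₅ c *₅ t

      collect : b *₅ (B v w +₅ -₅ s) +₅ c *₅ (B u w +₅ -₅ t) ≡ p +₅ -₅ p′
      collect = *₅-distrib-differences b c s t (B v w) (B u w)

  -- Up to scaling, the normals are (1,2b,2c), (0,1,c) and (0,0,1), that is 25 + 5 + 1 = 31 of them.
  -- Those starting with 0 are treated here: q(w) drops out and the condition becomes affine in w,
  -- with normal vector bv + cu.
  plane-at-infinity : ∀ b c v u s t →
    ∑ᵛ (λ w → ⟦ (b *₅ (B v w +₅ -₅ s) +₅ c *₅ (B u w +₅ -₅ t)) ≟₅ 0# ⟧)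
      ≡ hyperplane (combination b c v u) (b *₅ s +₅ c *₅ t)
  plane-at-infinity b c v u s t = ∑-cong (vectors n) (λ w → trans
    (cong (λ z → ⟦ z ≟₅ 0# ⟧) (*₅-distrib-differences b c s t (B v w) (B u w)))
    (trans (⟦-≟0⟧ (b *₅ B v w +₅ c *₅ B u w) (b *₅ s +₅ c *₅ t))
           (cong (λ z → ⟦ z ≟₅ (b *₅ s +₅ c *₅ t) ⟧)
             (trans (sym (B-combination b c v u w)) (B-sym w (combination b c v u))))))

  q≡1⇒≢0 : ∀ {v} → q v ≡ 1# → v ≢ 0ᴹ
  q≡1⇒≢0 {v} qv≡1 v≡0 = 0≢1 (trans (sym q-0) (trans (cong q (sym v≡0)) qv≡1))
    where
    0≢1 : 0# ≢ 1#
    0≢1 ()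

-- Radon inversion: of the lines (planes) of affine space over 𝔽₅, those through the origin
-- cover it 6 (31) times and every other point once (6 times).

lines-through-0 : ∀ α σ →
  ∑₅ (λ b → ⟦ (α +₅ 2# *₅ (b *₅ σ +₅ 0# *₅ σ)) ≟₅ 0# ⟧) + ⟦ (1# *₅ σ +₅ 0# *₅ σ) ≟₅ 0# ⟧
    ≡ + 5 * (⟦ α ≟₅ 0# ⟧ * ⟦ σ ≟₅ 0# ⟧) + 1ℤ
lines-through-0 = from-yes (all? λ α → all? λ σ →
  (∑₅ (λ b → ⟦ (α +₅ 2# *₅ (b *₅ σ +₅ 0# *₅ σ)) ≟₅ 0# ⟧) + ⟦ (1# *₅ σ +₅ 0# *₅ σ) ≟₅ 0# ⟧)
    ≟ℤ (+ 5 * (⟦ α ≟₅ 0# ⟧ * ⟦ σ ≟₅ 0# ⟧) + 1ℤ))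

planes-through-0 : ∀ α σ τ →
  ∑₅ (λ b → ∑₅ (λ c → ⟦ (α +₅ 2# *₅ (b *₅ σ +₅ c *₅ τ)) ≟₅ 0# ⟧))
    + (∑₅ (λ c → ⟦ (1# *₅ σ +₅ c *₅ τ) ≟₅ 0# ⟧) + ⟦ (0# *₅ σ +₅ 1# *₅ τ) ≟₅ 0# ⟧)
    ≡ + 25 * (⟦ α ≟₅ 0# ⟧ * (⟦ σ ≟₅ 0# ⟧ * ⟦ τ ≟₅ 0# ⟧)) + + 6
planes-through-0 = from-yes (all? λ α → all? λ σ → all? λ τ →
  (∑₅ (λ b → ∑₅ (λ c → ⟦ (α +₅ 2# *₅ (b *₅ σ +₅ c *₅ τ)) ≟₅ 0# ⟧))
    + (∑₅ (λ c → ⟦ (1# *₅ σ +₅ c *₅ τ) ≟₅ 0# ⟧) + ⟦ (0# *₅ σ +₅ 1# *₅ τ) ≟₅ 0# ⟧))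
    ≟ℤ (+ 25 * (⟦ α ≟₅ 0# ⟧ * (⟦ σ ≟₅ 0# ⟧ * ⟦ τ ≟₅ 0# ⟧)) + + 6))

-- The character sums at the point (1, s) for a unit vector, and at the point (1, s, t)
-- for two unit vectors v and u with B v u = β.

opaque
  charSum₁ : 𝔽₅ → ℤ
  charSum₁ s = ∑₅ (λ b → μ (1# +₅ 2# *₅ (b *₅ s +₅ 0# *₅ s)
    +₅ ((b *₅ b) *₅ 1# +₅ (0# *₅ 0#) *₅ 1# +₅ 2# *₅ (0# *₅ (b *₅ 1#)))))

  charSum₂ : 𝔽₅ → 𝔽₅ → 𝔽₅ → ℤ
  charSum₂ β s t = ∑₅ (λ b → ∑₅ (λ c → μ (1# +₅ 2# *₅ (b *₅ s +₅ c *₅ t)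
    +₅ ((b *₅ b) *₅ 1# +₅ (c *₅ c) *₅ 1# +₅ 2# *₅ (c *₅ (b *₅ β))))))

  charSum₁-def : ∀ s → charSum₁ s ≡ ∑₅ (λ b → μ (1# +₅ 2# *₅ (b *₅ s +₅ 0# *₅ s)
    +₅ ((b *₅ b) *₅ 1# +₅ (0# *₅ 0#) *₅ 1# +₅ 2# *₅ (0# *₅ (b *₅ 1#)))))
  charSum₁-def s = refl

  charSum₂-def : ∀ β s t → charSum₂ β s t ≡ ∑₅ (λ b → ∑₅ (λ c → μ (1# +₅ 2# *₅ (b *₅ s +₅ c *₅ t)
    +₅ ((b *₅ b) *₅ 1# +₅ (c *₅ c) *₅ 1# +₅ 2# *₅ (c *₅ (b *₅ β))))))
  charSum₂-def β s t = refl

-- Here φ is the indicator of the values of B that define a relation. In the number of related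
-- vectors, `weight` gives the coefficient of the main term X² and `twist` that of e, up to powers
-- of 5.
weight₁ weight₂ twist₁ : (𝔽₅ → ℤ) → ℤ
weight₁ φ = ∑₅ φ
weight₂ φ = ∑₅ (λ s → ∑₅ (λ t → φ s * φ t))
twist₁  φ = ∑₅ (λ s → φ s * charSum₁ s)

twist₂ : (𝔽₅ → ℤ) → 𝔽₅ → ℤ
twist₂ φ β = ∑₅ (λ s → ∑₅ (λ t → φ s * φ t * charSum₂ β s t))

∑₅-pick : ∀ (φ : 𝔽₅ → ℤ) x → ∑₅ (λ s → φ s * ⟦ x ≟₅ s ⟧) ≡ φ x
∑₅-pick φ x = trans
  (∑-cong (allFin 5) (λ s → trans (ℤ.*-comm (φ s) ⟦ x ≟₅ s ⟧)
    (cong (_* φ s) (⟦⟧-cong {P? = x ≟₅ s} {s ≟₅ x} (mk⇔ sym sym)))))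
  (∑₅-δ x φ)

indicator₀ indicator₂ indicator≢0 : 𝔽₅ → ℤ
indicator₀  x = ⟦ x ≟₅ 0# ⟧
indicator₂  x = ⟦ (x ≟₅ 2#) ⊎-dec (x ≟₅ (-₅ 2#)) ⟧
indicator≢0 x = ⟦ ¬? (x ≟₅ 0#) ⟧

opaque
  -- `charSum₂` belongs to the same opaque block and is unfolded along with it, so that the tables
  -- below are found by evaluation.
  unfolding charSum₁

  twist₁-indicator₀ : twist₁ indicator₀ ≡ -1ℤ
  twist₁-indicator₀ = refl

  twist₁-indicator₂ : twist₁ indicator₂ ≡ - + 2
  twist₁-indicator₂ = refl

  -- In this table and the two that follow, β = ±1 and β = ±2 give the same value. This coincidence
  -- is what produces strongly regular and Deza graphs.
  twist₂-indicator≢0 : ∀ β → twist₂ indicator≢0 β ≡ (if does (β ≟₅ 0#) then + 40 else + 30)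
  twist₂-indicator≢0 = from-yes (all? λ β → twist₂ indicator≢0 β ≟ℤ (if does (β ≟₅ 0#) then + 40 else + 30))

  twist₂-indicator₀ : ∀ β → twist₂ indicator₀ β ≡ (if does (β ≟₅ 0#) then + 5 else - + 5)
  twist₂-indicator₀ = from-yes (all? λ β → twist₂ indicator₀ β ≟ℤ (if does (β ≟₅ 0#) then + 5 else - + 5))

  twist₂-indicator₂ : ∀ β → twist₂ indicator₂ β ≡ (if does (β ≟₅ 0#) then - + 20 else - + 10)
  twist₂-indicator₂ = from-yes (all? λ β → twist₂ indicator₂ β ≟ℤ (if does (β ≟₅ 0#) then - + 20 else - + 10))

-- Counting unit vectors with prescribed inner products, in terms of X = 5ʲ and e = εX

module Counting {n : ℕ} (Q : QuadraticForm n) (nondegenerate : QuadraticForm.Nondegenerate Q)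
  (X e : ℤ) (5^n≡ : (+ 5) ^ n ≡ + 3125 * (X * X))
  (represent≡ : ∀ y → Form.represent Q y ≡ + 625 * (X * X) + + 25 * e * μ y) where

  open QuadraticForm Q renaming (form to q) using (B; homogeneous)
  open Form Q

  hyperplane≡ : ∀ x → x ≢ 0ᴹ → ∀ c → hyperplane x c ≡ + 625 * (X * X)
  hyperplane≡ x x≢0 c = ℤ.*-cancelˡ-≡ (+ 5) _ _
    (trans (hyperplane-≢0 nondegenerate x x≢0 c) (trans 5^n≡ (ℤ.*-assoc (+ 5) (+ 625) (X * X))))

  module _ (v : Vec 𝔽₅ n) (qv≡1 : q v ≡ 1#) where

    points₁ : 𝔽₅ → ℤ
    points₁ s = ∑ᵛ (λ w → ⟦ q w ≟₅ 1# ⟧ * ⟦ B v w ≟₅ s ⟧)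

    -- The incidence identity for lines is summed over all w. The six lines contribute 6·625X² plus
    -- the character terms; subtracting 5ⁿ = 3125X² leaves 625X², and dividing by 5 gives the count.
    -- Lines are obtained from the lemmas on planes by taking u = v and c = 0, whence the vanishing
    -- terms.
    points₁≡ : ∀ s → points₁ s ≡ + 125 * (X * X) + + 5 * e * charSum₁ s
    points₁≡ s = ℤ.*-cancelˡ-≡ (+ 5) _ _ (solution (points₁ s) (X * X) e (charSum₁ s) (begin
      + 5 * points₁ s + + 3125 * (X * X)
        ≡⟨ cong₂ _+_ (cong (+ 5 *_) (∑-cong (vectors n) (λ w → cong₂ _*_
             (⟦-≟0⟧ (q w) 1#) (⟦-≟0⟧ (B v w) s)))) (trans (∑ᵛ-one n) 5^n≡) ⟨
      + 5 * ∑ᵛ (λ w → ⟦ α w ≟₅ 0# ⟧ * ⟦ σ w ≟₅ 0# ⟧) + ∑ᵛ {n} (λ _ → 1ℤ)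
        ≡⟨ cong (_+ ∑ᵛ {n} (λ _ → 1ℤ)) (*-distribˡ-∑ (vectors n) (+ 5) (λ w → ⟦ α w ≟₅ 0# ⟧ * ⟦ σ w ≟₅ 0# ⟧)) ⟨
      ∑ᵛ (λ w → + 5 * (⟦ α w ≟₅ 0# ⟧ * ⟦ σ w ≟₅ 0# ⟧)) + ∑ᵛ {n} (λ _ → 1ℤ)
        ≡⟨ ∑-distrib-+ (vectors n) (λ w → + 5 * (⟦ α w ≟₅ 0# ⟧ * ⟦ σ w ≟₅ 0# ⟧)) (λ _ → 1ℤ) ⟨
      ∑ᵛ (λ w → + 5 * (⟦ α w ≟₅ 0# ⟧ * ⟦ σ w ≟₅ 0# ⟧) + 1ℤ)
        ≡⟨ ∑-cong (vectors n) (λ w → lines-through-0 (α w) (σ w)) ⟨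
      ∑ᵛ (λ w → ∑₅ (λ b → affine w b) + ⟦ (1# *₅ σ w +₅ 0# *₅ σ w) ≟₅ 0# ⟧)
        ≡⟨ ∑-distrib-+ (vectors n) (λ w → ∑₅ (λ b → affine w b)) (λ w → ⟦ (1# *₅ σ w +₅ 0# *₅ σ w) ≟₅ 0# ⟧) ⟩
      ∑ᵛ (λ w → ∑₅ (λ b → affine w b)) + ∑ᵛ (λ w → ⟦ (1# *₅ σ w +₅ 0# *₅ σ w) ≟₅ 0# ⟧)
        ≡⟨ cong₂ _+_
             (trans (∑-comm (vectors n) (allFin 5) affine)
               (trans (∑-cong (allFin 5) affine≡)
                      (∑-affine (allFin 5) (+ 625 * (X * X)) (+ 25 * e) (λ b → μ (argument b)))))
             (trans (plane-at-infinity 1# 0# v v s s) (hyperplane≡ (combination 1# 0# v v) v≢0 _)) ⟩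
      + 625 * (X * X) * + 5 + + 25 * e * ∑₅ (λ b → μ (argument b)) + + 625 * (X * X)
        ≡⟨ cong (λ S → + 625 * (X * X) * + 5 + + 25 * e * S + + 625 * (X * X)) (charSum₁-def s) ⟨
      + 625 * (X * X) * + 5 + + 25 * e * charSum₁ s + + 625 * (X * X) ∎))
      where
      open ≡-Reasoning
      α σ : Vec 𝔽₅ n → 𝔽₅
      α w = q w +₅ -₅ 1#
      σ w = B v w +₅ -₅ s

      affine : Vec 𝔽₅ n → 𝔽₅ → ℤ
      affine w b = ⟦ (α w +₅ 2# *₅ (b *₅ σ w +₅ 0# *₅ σ w)) ≟₅ 0# ⟧

      argument : 𝔽₅ → 𝔽₅
      argument b = 1# +₅ 2# *₅ (b *₅ s +₅ 0# *₅ s)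
        +₅ ((b *₅ b) *₅ 1# +₅ (0# *₅ 0#) *₅ 1# +₅ 2# *₅ (0# *₅ (b *₅ 1#)))

      affine≡ : ∀ b → ∑ᵛ (λ w → affine w b) ≡ + 625 * (X * X) + + 25 * e * μ (argument b)
      affine≡ b = trans (plane b 0# v v s s) (trans (represent≡ _)
        (cong (λ z → + 625 * (X * X) + + 25 * e * μ (1# +₅ 2# *₅ (b *₅ s +₅ 0# *₅ s) +₅ z))
          (trans (q-combination b 0# v v)
            (cong₂ (λ g h → (b *₅ b) *₅ g +₅ (0# *₅ 0#) *₅ g +₅ 2# *₅ (0# *₅ (b *₅ h)))
                   qv≡1 (trans (B-diagonal v) qv≡1)))))

      v≢0 : combination 1# 0# v v ≢ 0ᴹ
      v≢0 e = q≡1⇒≢0 qv≡1 (trans (sym (trans (cong₂ _+ᴹ_ (V.*ₗ-identityˡ v) (V.*ₗ-zeroˡ v)) (V.+ᴹ-identityʳ v))) e)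

      solution : ∀ N x e S → + 5 * N + + 3125 * x ≡ + 625 * x * + 5 + + 25 * e * S + + 625 * x →
                 + 5 * N ≡ + 5 * (+ 125 * x + + 5 * e * S)
      solution N x e S eq = trans (lhs N x) (trans (cong (_- + 3125 * x) eq) (rhs x e S))
        where
        lhs : ∀ N x → + 5 * N ≡ + 5 * N + + 3125 * x - + 3125 * x
        lhs = solve-∀
        rhs : ∀ x e S → + 625 * x * + 5 + + 25 * e * S + + 625 * x - + 3125 * x ≡ + 5 * (+ 125 * x + + 5 * e * S)
        rhs = solve-∀

    -- The sum is fibred over the value s of B(v,w), and each fibre is counted by `points₁≡`.
    total₁ : ∀ φ → ∑ᵛ (λ w → ⟦ q w ≟₅ 1# ⟧ * φ (B v w))
                   ≡ + 125 * (X * X) * weight₁ φ + + 5 * e * twist₁ φ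
    total₁ φ = begin
      ∑ᵛ (λ w → ⟦ q w ≟₅ 1# ⟧ * φ (B v w))
        ≡⟨ ∑-cong (vectors n) (λ w → cong (⟦ q w ≟₅ 1# ⟧ *_) (∑₅-pick φ (B v w))) ⟨
      ∑ᵛ (λ w → ⟦ q w ≟₅ 1# ⟧ * ∑₅ (λ s → φ s * ⟦ B v w ≟₅ s ⟧))
        ≡⟨ ∑-cong (vectors n) (λ w → trans
             (sym (*-distribˡ-∑ (allFin 5) ⟦ q w ≟₅ 1# ⟧ (λ s → φ s * ⟦ B v w ≟₅ s ⟧)))
             (∑-cong (allFin 5) (λ s → swap ⟦ q w ≟₅ 1# ⟧ (φ s) ⟦ B v w ≟₅ s ⟧))) ⟩
      ∑ᵛ (λ w → ∑₅ (λ s → φ s * (⟦ q w ≟₅ 1# ⟧ * ⟦ B v w ≟₅ s ⟧)))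
        ≡⟨ ∑-comm (vectors n) (allFin 5) (λ w s → φ s * (⟦ q w ≟₅ 1# ⟧ * ⟦ B v w ≟₅ s ⟧)) ⟩
      ∑₅ (λ s → ∑ᵛ (λ w → φ s * (⟦ q w ≟₅ 1# ⟧ * ⟦ B v w ≟₅ s ⟧)))
        ≡⟨ ∑-cong (allFin 5) (λ s → trans
             (*-distribˡ-∑ (vectors n) (φ s) (λ w → ⟦ q w ≟₅ 1# ⟧ * ⟦ B v w ≟₅ s ⟧))
             (trans (cong (φ s *_) (points₁≡ s)) (expand (φ s) (X * X) e (charSum₁ s)))) ⟩
      ∑₅ (λ s → + 125 * (X * X) * φ s + + 5 * e * (φ s * charSum₁ s))
        ≡⟨ ∑-linear (allFin 5) (+ 125 * (X * X)) (+ 5 * e) φ (λ s → φ s * charSum₁ s) ⟩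
      + 125 * (X * X) * weight₁ φ + + 5 * e * twist₁ φ ∎
      where
      open ≡-Reasoning
      swap : ∀ a b c → a * (b * c) ≡ b * (a * c)
      swap = solve-∀
      expand : ∀ f x e S → f * (+ 125 * x + + 5 * e * S) ≡ + 125 * x * f + + 5 * e * (f * S)
      expand = solve-∀

  module _ (v u : Vec 𝔽₅ n) (qv≡1 : q v ≡ 1#) (qu≡1 : q u ≡ 1#) (v≢u : v ≢ u) (v≢-u : v ≢ -ᴹ u) where

    points₂ : 𝔽₅ → 𝔽₅ → ℤ
    points₂ s t = ∑ᵛ (λ w → ⟦ q w ≟₅ 1# ⟧ * (⟦ B v w ≟₅ s ⟧ * ⟦ B u w ≟₅ t ⟧))

    -- If v = -c u with q v = q u = 1 then c² = 1.
    independent : ∀ c → combination 1# c v u ≢ 0ᴹ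
    independent c e = impossible (square (-₅ c) c²≡1)
      where
      v≡-cu : v ≡ (-₅ c) *ₗ u
      v≡-cu = trans (sym (V.*ₗ-identityˡ v)) (trans (inverseˡ-unique (1# *ₗ v) (c *ₗ u) e)
                (trans (-ᴹ≡-1*ₗ (c *ₗ u)) (trans (sym (V.*ₗ-assoc (-₅ 1#) c u))
                  (cong (_*ₗ u) (from-yes (all? λ a → (-₅ 1# *₅ a) ≟₅ (-₅ a)) c)))))
        where open GroupProperties (AbelianGroup.group V.+ᴹ-abelianGroup)

      c²≡1 : (-₅ c *₅ -₅ c) *₅ 1# ≡ 1#
      c²≡1 = trans (cong ((-₅ c *₅ -₅ c) *₅_) (sym qu≡1))
               (trans (sym (homogeneous (-₅ c) u)) (trans (cong q (sym v≡-cu)) qv≡1))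

      square : ∀ a → (a *₅ a) *₅ 1# ≡ 1# → a ≡ 1# ⊎ a ≡ -₅ 1#
      square = from-yes (all? λ a → (((a *₅ a) *₅ 1#) ≟₅ 1#) →-dec ((a ≟₅ 1#) ⊎-dec (a ≟₅ (-₅ 1#))))

      impossible : ¬ (-₅ c ≡ 1# ⊎ -₅ c ≡ -₅ 1#)
      impossible (inj₁ -c≡1)  = v≢u (trans v≡-cu (trans (cong (_*ₗ u) -c≡1) (V.*ₗ-identityˡ u)))
      impossible (inj₂ -c≡-1) = v≢-u (trans v≡-cu (trans (cong (_*ₗ u) -c≡-1) (sym (-ᴹ≡-1*ₗ u))))

    -- The main terms give 31·625X² - 6·3125X² = 625X², to be divided by 25. Independence of v and u
    -- enters through the six planes with normals (0,1,c) and (0,0,1), whose normal vectors in 𝔽₅ⁿ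
    -- must be nonzero.
    points₂≡ : ∀ s t → points₂ s t ≡ + 25 * (X * X) + e * charSum₂ (B v u) s t
    points₂≡ s t = ℤ.*-cancelˡ-≡ (+ 25) _ _ (solution (points₂ s t) (X * X) e (charSum₂ (B v u) s t) (begin
      + 25 * points₂ s t + + 6 * (+ 3125 * (X * X))
        ≡⟨ cong₂ _+_ (cong (+ 25 *_) (∑-cong (vectors n) (λ w → cong₂ _*_ (⟦-≟0⟧ (q w) 1#)
             (cong₂ _*_ (⟦-≟0⟧ (B v w) s) (⟦-≟0⟧ (B u w) t)))))
             (trans (∑-const (vectors n) (+ 6)) (cong (+ 6 *_) (trans (∑ᵛ-one n) 5^n≡))) ⟨
      + 25 * ∑ᵛ point + ∑ᵛ {n} (λ _ → + 6)
        ≡⟨ cong (_+ ∑ᵛ {n} (λ _ → + 6)) (*-distribˡ-∑ (vectors n) (+ 25) point) ⟨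
      ∑ᵛ (λ w → + 25 * point w) + ∑ᵛ {n} (λ _ → + 6)
        ≡⟨ ∑-distrib-+ (vectors n) (λ w → + 25 * point w) (λ _ → + 6) ⟨
      ∑ᵛ (λ w → + 25 * point w + + 6)
        ≡⟨ ∑-cong (vectors n) (λ w → planes-through-0 (α w) (σ w) (τ w)) ⟨
      ∑ᵛ (λ w → ∑₅ (λ b → ∑₅ (λ c → affine w b c)) + (∑₅ (λ c → infinite w 1# c) + infinite w 0# 1#))
        ≡⟨ trans (∑-distrib-+ (vectors n) (λ w → ∑₅ (λ b → ∑₅ (λ c → affine w b c)))
                   (λ w → ∑₅ (λ c → infinite w 1# c) + infinite w 0# 1#))
                 (cong (λ z → ∑ᵛ (λ w → ∑₅ (λ b → ∑₅ (λ c → affine w b c))) + z)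
                   (∑-distrib-+ (vectors n) (λ w → ∑₅ (λ c → infinite w 1# c)) (λ w → infinite w 0# 1#))) ⟩
      ∑ᵛ (λ w → ∑₅ (λ b → ∑₅ (λ c → affine w b c)))
        + (∑ᵛ (λ w → ∑₅ (λ c → infinite w 1# c)) + ∑ᵛ (λ w → infinite w 0# 1#))
        ≡⟨ cong₂ _+_
             (trans (∑-comm (vectors n) (allFin 5) (λ w b → ∑₅ (λ c → affine w b c)))
               (trans (∑-cong (allFin 5) (λ b → trans (∑-comm (vectors n) (allFin 5) (λ w c → affine w b c))
                        (trans (∑-cong (allFin 5) (λ c → affine≡ b c))
                               (∑-affine (allFin 5) (+ 625 * (X * X)) (+ 25 * e) (λ c → μ (argument b c))))))
                      (∑-affine (allFin 5) (+ 625 * (X * X) * + 5) (+ 25 * e) (λ b → ∑₅ (λ c → μ (argument b c))))))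
             (cong₂ _+_
               (trans (∑-comm (vectors n) (allFin 5) (λ w c → infinite w 1# c))
                 (trans (∑-cong (allFin 5) (λ c → trans (plane-at-infinity 1# c v u s t)
                          (hyperplane≡ (combination 1# c v u) (independent c) (1# *₅ s +₅ c *₅ t))))
                        (∑-const (allFin 5) (+ 625 * (X * X)))))
               (trans (plane-at-infinity 0# 1# v u s t)
                      (hyperplane≡ (combination 0# 1# v u) u≢0 (0# *₅ s +₅ 1# *₅ t)))) ⟩
      + 625 * (X * X) * + 5 * + 5 + + 25 * e * ∑₅ (λ b → ∑₅ (λ c → μ (argument b c)))
        + (+ 625 * (X * X) * + 5 + + 625 * (X * X))
        ≡⟨ cong (λ S → + 625 * (X * X) * + 5 * + 5 + + 25 * e * S + (+ 625 * (X * X) * + 5 + + 625 * (X * X)))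
                (charSum₂-def (B v u) s t) ⟨
      + 625 * (X * X) * + 5 * + 5 + + 25 * e * charSum₂ (B v u) s t
        + (+ 625 * (X * X) * + 5 + + 625 * (X * X)) ∎))
      where
      open ≡-Reasoning
      α σ τ : Vec 𝔽₅ n → 𝔽₅
      α w = q w +₅ -₅ 1#
      σ w = B v w +₅ -₅ s
      τ w = B u w +₅ -₅ t

      point : Vec 𝔽₅ n → ℤ
      point w = ⟦ α w ≟₅ 0# ⟧ * (⟦ σ w ≟₅ 0# ⟧ * ⟦ τ w ≟₅ 0# ⟧)

      affine infinite : Vec 𝔽₅ n → 𝔽₅ → 𝔽₅ → ℤ
      affine w b c   = ⟦ (α w +₅ 2# *₅ (b *₅ σ w +₅ c *₅ τ w)) ≟₅ 0# ⟧
      infinite w b c = ⟦ (b *₅ σ w +₅ c *₅ τ w) ≟₅ 0# ⟧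

      argument : 𝔽₅ → 𝔽₅ → 𝔽₅
      argument b c = 1# +₅ 2# *₅ (b *₅ s +₅ c *₅ t)
        +₅ ((b *₅ b) *₅ 1# +₅ (c *₅ c) *₅ 1# +₅ 2# *₅ (c *₅ (b *₅ B v u)))

      affine≡ : ∀ b c → ∑ᵛ (λ w → affine w b c) ≡ + 625 * (X * X) + + 25 * e * μ (argument b c)
      affine≡ b c = trans (plane b c v u s t) (trans (represent≡ _)
        (cong (λ z → + 625 * (X * X) + + 25 * e * μ (1# +₅ 2# *₅ (b *₅ s +₅ c *₅ t) +₅ z))
          (trans (q-combination b c v u)
            (cong₂ (λ g h → (b *₅ b) *₅ g +₅ (c *₅ c) *₅ h +₅ 2# *₅ (c *₅ (b *₅ B v u))) qv≡1 qu≡1))))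

      u≢0 : combination 0# 1# v u ≢ 0ᴹ
      u≢0 e = q≡1⇒≢0 qu≡1 (trans (sym (trans (cong₂ _+ᴹ_ (V.*ₗ-zeroˡ v) (V.*ₗ-identityˡ u)) (V.+ᴹ-identityˡ u))) e)

      solution : ∀ N x e S →
        + 25 * N + + 6 * (+ 3125 * x) ≡ + 625 * x * + 5 * + 5 + + 25 * e * S + (+ 625 * x * + 5 + + 625 * x) →
        + 25 * N ≡ + 25 * (+ 25 * x + e * S)
      solution N x e S eq = trans (lhs N x) (trans (cong (_- + 6 * (+ 3125 * x)) eq) (rhs x e S))
        where
        lhs : ∀ N x → + 25 * N ≡ + 25 * N + + 6 * (+ 3125 * x) - + 6 * (+ 3125 * x)
        lhs = solve-∀
        rhs : ∀ x e S → + 625 * x * + 5 * + 5 + + 25 * e * S + (+ 625 * x * + 5 + + 625 * x) - + 6 * (+ 3125 * x)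
                        ≡ + 25 * (+ 25 * x + e * S)
        rhs = solve-∀

    total₂ : ∀ φ → ∑ᵛ (λ w → ⟦ q w ≟₅ 1# ⟧ * (φ (B v w) * φ (B u w)))
                   ≡ + 25 * (X * X) * weight₂ φ + e * twist₂ φ (B v u)
    total₂ φ = begin
      ∑ᵛ (λ w → ⟦ q w ≟₅ 1# ⟧ * (φ (B v w) * φ (B u w)))
        ≡⟨ ∑-cong (vectors n) (λ w → sym (spread ⟦ q w ≟₅ 1# ⟧ (B v w) (B u w))) ⟩
      ∑ᵛ (λ w → ∑₅ (λ s → ∑₅ (λ t → φ s * φ t * point w s t)))
        ≡⟨ ∑-comm (vectors n) (allFin 5) (λ w s → ∑₅ (λ t → φ s * φ t * point w s t)) ⟩
      ∑₅ (λ s → ∑ᵛ (λ w → ∑₅ (λ t → φ s * φ t * point w s t)))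
        ≡⟨ ∑-cong (allFin 5) (λ s → trans
             (∑-comm (vectors n) (allFin 5) (λ w t → φ s * φ t * point w s t))
             (trans (∑-cong (allFin 5) (λ t → trans
                      (*-distribˡ-∑ (vectors n) (φ s * φ t) (λ w → point w s t))
                      (trans (cong (φ s * φ t *_) (points₂≡ s t))
                             (expand (φ s * φ t) (X * X) e (charSum₂ (B v u) s t)))))
                    (∑-linear (allFin 5) (+ 25 * (X * X)) e (λ t → φ s * φ t)
                              (λ t → φ s * φ t * charSum₂ (B v u) s t)))) ⟩
      ∑₅ (λ s → + 25 * (X * X) * ∑₅ (λ t → φ s * φ t) + e * ∑₅ (λ t → φ s * φ t * charSum₂ (B v u) s t))
        ≡⟨ ∑-linear (allFin 5) (+ 25 * (X * X)) e (λ s → ∑₅ (λ t → φ s * φ t))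
             (λ s → ∑₅ (λ t → φ s * φ t * charSum₂ (B v u) s t)) ⟩
      + 25 * (X * X) * weight₂ φ + e * twist₂ φ (B v u) ∎
      where
      open ≡-Reasoning

      point : Vec 𝔽₅ n → 𝔽₅ → 𝔽₅ → ℤ
      point w s t = ⟦ q w ≟₅ 1# ⟧ * (⟦ B v w ≟₅ s ⟧ * ⟦ B u w ≟₅ t ⟧)

      expand : ∀ f x e S → f * (+ 25 * x + e * S) ≡ + 25 * x * f + e * (f * S)
      expand = solve-∀

      swap₁ : ∀ f g c x y → f * g * (c * (x * y)) ≡ c * (f * x) * (g * y)
      swap₁ = solve-∀

      swap₂ : ∀ c f g → c * f * g ≡ c * g * f
      swap₂ = solve-∀

      spread : ∀ c x y → ∑₅ (λ s → ∑₅ (λ t → φ s * φ t * (c * (⟦ x ≟₅ s ⟧ * ⟦ y ≟₅ t ⟧)))) ≡ c * (φ x * φ y)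
      spread c x y = begin
        ∑₅ (λ s → ∑₅ (λ t → φ s * φ t * (c * (⟦ x ≟₅ s ⟧ * ⟦ y ≟₅ t ⟧))))
          ≡⟨ ∑-cong (allFin 5) (λ s → trans
               (∑-cong (allFin 5) (λ t → swap₁ (φ s) (φ t) c ⟦ x ≟₅ s ⟧ ⟦ y ≟₅ t ⟧))
               (trans (*-distribˡ-∑ (allFin 5) (c * (φ s * ⟦ x ≟₅ s ⟧)) (λ t → φ t * ⟦ y ≟₅ t ⟧))
                 (trans (cong (c * (φ s * ⟦ x ≟₅ s ⟧) *_) (∑₅-pick φ y))
                        (swap₂ c (φ s * ⟦ x ≟₅ s ⟧) (φ y))))) ⟩
        ∑₅ (λ s → c * φ y * (φ s * ⟦ x ≟₅ s ⟧))
          ≡⟨ *-distribˡ-∑ (allFin 5) (c * φ y) (λ s → φ s * ⟦ x ≟₅ s ⟧) ⟩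
        c * φ y * ∑₅ (λ s → φ s * ⟦ x ≟₅ s ⟧)
          ≡⟨ cong (c * φ y *_) (∑₅-pick φ x) ⟩
        c * φ y * φ x
          ≡⟨ regroup c (φ x) (φ y) ⟩
        c * (φ x * φ y) ∎
        where
        regroup : ∀ c f g → c * g * f ≡ c * (f * g)
        regroup = solve-∀

-- Sizes of setoids with canonical representatives

lookup-injective : ∀ {xs : List A} → Unique xs → Injective _≡_ _≡_ (lookup xs)
lookup-injective {xs = x ∷ xs} (x∉xs ∷ xs!) {zero}  {zero}  eq = refl
lookup-injective {xs = x ∷ xs} (x∉xs ∷ xs!) {zero}  {suc j} eq = contradiction eq (All.lookup x∉xs (∈.∈-lookup j))
lookup-injective {xs = x ∷ xs} (x∉xs ∷ xs!) {suc i} {zero}  eq = contradiction (sym eq) (All.lookup x∉xs (∈.∈-lookup i))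
lookup-injective {xs = x ∷ xs} (x∉xs ∷ xs!) {suc i} {suc j} eq = cong suc (lookup-injective xs! eq)

module _ (S : Setoid 0ℓ 0ℓ) {xs : List A} (xs! : Unique xs) where
  open Setoid S using (_≈_; Carrier)

  -- A complete invariant `f` of the classes turns counting a quotient into counting a
  -- duplicate-free list: a class is sent to the position of its invariant.
  hasSize-length : (f : Carrier → A) → (∀ {x y} → x ≈ y → f x ≡ f y) → (∀ {x y} → f x ≡ f y → x ≈ y) →
                   (∀ x → f x ∈ xs) → (∀ {a} → a ∈ xs → ∃[ x ] f x ≡ a) → HasSize S (length xs)
  hasSize-length f f-cong f-injective f∈xs f-onto = record
    { to        = to
    ; from      = from
    ; to-cong   = to-cong
    ; from-cong = λ { refl → Setoid.refl S }
    ; inverse   = (λ { {i} y≈ → trans (to-cong y≈) (lookup-injective xs!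
                        (trans (lookup-to (from i)) (f-from i))) })
                , (λ { {x} refl → f-injective (trans (f-from (to x)) (lookup-to x)) })
    }
    where
    to : Carrier → Fin (length xs)
    to x = Any.index (f∈xs x)

    from : Fin (length xs) → Carrier
    from i = proj₁ (f-onto (∈.∈-lookup i))

    f-from : ∀ i → f (from i) ≡ lookup xs i
    f-from i = proj₂ (f-onto (∈.∈-lookup i))

    lookup-to : ∀ x → lookup xs (to x) ≡ f x
    lookup-to x = sym (Any.lookup-index (f∈xs x))

    to-cong : ∀ {x y} → x ≈ y → to x ≡ to y
    to-cong {x} {y} x≈y =
      lookup-injective xs! (trans (lookup-to x) (trans (f-cong x≈y) (sym (lookup-to y))))

-- Needed for the children: with a ≠ b, a pair with a common neighbours cannot also have b.
hasSize-unique : ∀ {S : Setoid 0ℓ 0ℓ} {c c′} → HasSize S c → HasSize S c′ → c ≡ c′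
hasSize-unique S↔c S↔c′ = ↔⇒≡ (Compose.inverse (Symmetry.inverse S↔c) S↔c′)

-- The class {v , -v} of a nonzero vector is represented by the one whose first nonzero
-- coordinate is 1 or 2.

leading : ∀ {n} → Vec 𝔽₅ n → 𝔽₅
leading []      = 0#
leading (x ∷ v) = if does (x ≟₅ 0#) then leading v else x

leading≡0⇒≡0 : ∀ {n} (v : Vec 𝔽₅ n) → leading v ≡ 0# → v ≡ 0ᴹ
leading≡0⇒≡0 []           lead≡0 = refl
leading≡0⇒≡0 (zero  ∷ v) lead≡0 = cong (0# ∷_) (leading≡0⇒≡0 v lead≡0)

leading-neg : ∀ {n} (v : Vec 𝔽₅ n) → leading (-ᴹ v) ≡ -₅ leading v
leading-neg []       = refl
leading-neg (0F ∷ v) = leading-neg v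
leading-neg (1F ∷ v) = refl
leading-neg (2F ∷ v) = refl
leading-neg (3F ∷ v) = refl
leading-neg (4F ∷ v) = refl

Canonical : ∀ {n} → Vec 𝔽₅ n → Set
Canonical v = leading v ≡ 1# ⊎ leading v ≡ 2#

opaque
  canonical? : ∀ {n} (v : Vec 𝔽₅ n) → Dec (Canonical v)
  canonical? v = (leading v ≟₅ 1#) ⊎-dec (leading v ≟₅ 2#)

-- Negation exchanges {1,2} with {4,3} and negates the leading coordinate, which is nonzero.
canonical-xor : ∀ {n} (v : Vec 𝔽₅ n) → v ≢ 0ᴹ → (Canonical v × ¬ Canonical (-ᴹ v)) ⊎ (¬ Canonical v × Canonical (-ᴹ v))
canonical-xor v v≢0 =
  subst (λ z → (Canonical v × ¬ (z ≡ 1# ⊎ z ≡ 2#)) ⊎ (¬ Canonical v × (z ≡ 1# ⊎ z ≡ 2#)))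
        (sym (leading-neg v)) (signs (leading v) (v≢0 ∘ leading≡0⇒≡0 v))
  where
  IsOneOrTwo? : ∀ z → Dec (z ≡ 1# ⊎ z ≡ 2#)
  IsOneOrTwo? z = (z ≟₅ 1#) ⊎-dec (z ≟₅ 2#)

  signs : ∀ z → z ≢ 0# → ((z ≡ 1# ⊎ z ≡ 2#) × ¬ (-₅ z ≡ 1# ⊎ -₅ z ≡ 2#)) ⊎
                         (¬ (z ≡ 1# ⊎ z ≡ 2#) × (-₅ z ≡ 1# ⊎ -₅ z ≡ 2#))
  signs = from-yes (all? λ z → ¬? (z ≟₅ 0#) →-dec
            ((IsOneOrTwo? z ×-dec ¬? (IsOneOrTwo? (-₅ z))) ⊎-dec
             (¬? (IsOneOrTwo? z) ×-dec IsOneOrTwo? (-₅ z))))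

halve : ∀ {c E} → + 2 * + c ≡ E → c ≡ ∣ E ∣ / 2
halve {c} 2c≡E = sym (trans (cong (λ E → ∣ E ∣ / 2) (trans (sym 2c≡E) (trans (ℤ.*-comm (+ 2) (+ c)) (sym (ℤ.pos-* c 2)))))
                            (m*n/n≡m c 2))

-- From numbers of vectors to numbers of classes {v , -v}

module Classes {n : ℕ} (Q : QuadraticForm n) where
  open QuadraticForm Q renaming (form to q) using ()
  open Form Q

  module _ {P : Vec 𝔽₅ n → Set} (P? : ∀ w → Dec (P w)) (P-neg : ∀ {w} → P w → P (-ᴹ w)) where

    private
      R : Vec 𝔽₅ n → Set
      R w = q w ≡ 1# × P w

      R? : ∀ w → Dec (R w)
      R? w = (q w ≟₅ 1#) ×-dec P? w

      R-neg : ∀ {w} → R w → R (-ᴹ w)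
      R-neg (qw≡1 , p) = trans (q-neg _) qw≡1 , P-neg p

      representative? : ∀ w → Dec (R w × Canonical w)
      representative? w = R? w ×-dec canonical? w

      representatives : List (Vec 𝔽₅ n)
      representatives = filter representative? (vectors n)

    -- Exactly one of w and -w is canonical, and the sum over -w equals the sum over w.
    length-representatives : + 2 * + length representatives ≡ ∑ᵛ (λ w → ⟦ R? w ⟧)
    length-representatives = begin
      + 2 * + length representatives
        ≡⟨ cong (+ 2 *_) (length-filter representative? (vectors n)) ⟩
      + 2 * S
        ≡⟨ double S ⟩
      S + S
        ≡⟨ cong (λ s → S + s) (∑ᵛ-negate (λ w → ⟦ representative? w ⟧)) ⟨
      S + ∑ᵛ (λ w → ⟦ representative? (-ᴹ w) ⟧)
        ≡⟨ ∑-distrib-+ (vectors n) (λ w → ⟦ representative? w ⟧) (λ w → ⟦ representative? (-ᴹ w) ⟧) ⟨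
      ∑ᵛ (λ w → ⟦ representative? w ⟧ + ⟦ representative? (-ᴹ w) ⟧)
        ≡⟨ ∑-cong (vectors n) split ⟨
      ∑ᵛ (λ w → ⟦ R? w ⟧) ∎
      where
      open ≡-Reasoning
      S = ∑ᵛ (λ w → ⟦ representative? w ⟧)

      double : ∀ s → + 2 * s ≡ s + s
      double = solve-∀

      split : ∀ w → ⟦ R? w ⟧ ≡ ⟦ representative? w ⟧ + ⟦ representative? (-ᴹ w) ⟧
      split w = cases (R? w)
        where
        cases : Dec (R w) → ⟦ R? w ⟧ ≡ ⟦ representative? w ⟧ + ⟦ representative? (-ᴹ w) ⟧
        cases (no ¬r) = trans (⟦⟧-false (R? w) ¬r) (sym (cong₂ _+_
          (⟦⟧-false (representative? w) (¬r ∘ proj₁))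
          (⟦⟧-false (representative? (-ᴹ w)) (λ (r , _) → ¬r (subst R (-ᴹ-involutive w) (R-neg r))))))
        cases (yes r) with canonical-xor w (q≡1⇒≢0 (proj₁ r))
        ... | inj₁ (c , ¬c⁻) = trans (⟦⟧-true (R? w) r) (sym (cong₂ _+_
          (⟦⟧-true (representative? w) (r , c)) (⟦⟧-false (representative? (-ᴹ w)) (¬c⁻ ∘ proj₂))))
        ... | inj₂ (¬c , c⁻) = trans (⟦⟧-true (R? w) r) (sym (cong₂ _+_
          (⟦⟧-false (representative? w) (¬c ∘ proj₂)) (⟦⟧-true (representative? (-ᴹ w)) (R-neg r , c⁻))))

    representative : Vec 𝔽₅ n → Vec 𝔽₅ n
    representative w = if does (canonical? w) then w else -ᴹ w

    private
      representative-canonical : ∀ {w} → R w → R (representative w) × Canonical (representative w)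
      representative-canonical {w} r with canonical? w
      ... | yes c = r , c
      ... | no ¬c with canonical-xor w (q≡1⇒≢0 (proj₁ r))
      ...   | inj₁ (c , _)  = contradiction c ¬c
      ...   | inj₂ (_ , c⁻) = R-neg r , c⁻

      representative-fixed : ∀ {w} → Canonical w → representative w ≡ w
      representative-fixed {w} c with canonical? w
      ... | yes _ = refl
      ... | no ¬c = contradiction c ¬c

      representative-neg : ∀ {w} → w ≢ 0ᴹ → representative (-ᴹ w) ≡ representative w
      representative-neg {w} w≢0 with canonical? w | canonical? (-ᴹ w) | canonical-xor w w≢0
      ... | yes _ | no _   | _               = -ᴹ-involutive w
      ... | no _  | yes _  | _               = refl
      ... | yes c | yes c⁻ | inj₁ (_ , ¬c⁻) = contradiction c⁻ ¬c⁻
      ... | yes c | yes c⁻ | inj₂ (¬c , _)  = contradiction c ¬c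
      ... | no ¬c | no ¬c⁻ | inj₁ (c , _)   = contradiction c ¬c
      ... | no ¬c | no ¬c⁻ | inj₂ (_ , c⁻)  = contradiction c⁻ ¬c⁻

      representative-injective : ∀ {v w} → representative v ≡ representative w → v ≡ w ⊎ v ≡ -ᴹ w
      representative-injective {v} {w} eq with does (canonical? v) | does (canonical? w)
      ... | true  | true  = inj₁ eq
      ... | true  | false = inj₂ eq
      ... | false | true  = inj₂ (trans (sym (-ᴹ-involutive v)) (cong -ᴹ_ eq))
      ... | false | false = inj₁ (trans (sym (-ᴹ-involutive v)) (trans (cong -ᴹ_ eq) (-ᴹ-involutive w)))

    subsetHasSize : ∀ c → + 2 * + c ≡ ∑ᵛ (λ w → ⟦ R? w ⟧) → SubsetHasSize (S⁺ Q) (λ w → P (proj₁ w)) c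
    subsetHasSize c 2c≡ = subst (SubsetHasSize (S⁺ Q) (λ w → P (proj₁ w))) length≡c
      (hasSize-length (On.setoid (S⁺ Q) proj₁) (Unique.filter⁺ representative? (vectors-unique n))
        (λ ((w , _) , _) → representative w)
        (λ { {_} {(w , qw≡1) , _} (inj₁ refl) → refl
           ; {_} {(w , qw≡1) , _} (inj₂ refl) → representative-neg (q≡1⇒≢0 qw≡1) })
        representative-injective
        (λ ((w , qw≡1) , p) → ∈.∈-filter⁺ representative? (∈-vectors (representative w))
                                (representative-canonical (qw≡1 , p)))
        (λ w∈ → let (qw≡1 , p) , c = proj₂ (∈.∈-filter⁻ representative? {xs = vectors n} w∈)
                in ((_ , qw≡1) , p) , representative-fixed c))
      where
      length≡c : length representatives ≡ c
      length≡c = ℤ.+-injective (ℤ.*-cancelˡ-≡ (+ 2) _ _ (trans length-representatives (sym 2c≡)))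

    -- Being a number of vectors that come in pairs ±w, `E` is automatically nonnegative and even.
    -- This form serves the graph of A₁ + A₂, for whose parameters no closed form is asked.
    subsetHasSize-half : ∀ {E} → ∑ᵛ (λ w → ⟦ R? w ⟧) ≡ E → SubsetHasSize (S⁺ Q) (λ w → P (proj₁ w)) (∣ E ∣ / 2)
    subsetHasSize-half sum≡ = subst (SubsetHasSize (S⁺ Q) (λ w → P (proj₁ w)))
      (halve (trans length-representatives sum≡))
      (subsetHasSize (length representatives) length-representatives)

  hasSize : ∀ c → + 2 * + c ≡ represent 1# → HasSize (S⁺ Q) c
  hasSize c 2c≡ = record
    { to        = λ w → to (w , tt)
    ; from      = λ i → proj₁ (from i)
    ; to-cong   = to-cong
    ; from-cong = from-cong
    ; inverse   = inverseˡ , inverseʳ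
    }
    where
    open Inverse (subsetHasSize {P = λ _ → ⊤} (λ _ → yes tt) (λ _ → tt) c
      (trans 2c≡ (∑-cong (vectors n) (λ w → sym (trans (⟦⟧-× (q w ≟₅ 1#) (yes tt)) (ℤ.*-identityʳ _))))))

-- The three graphs

indicator≢0-neg : ∀ x → indicator≢0 (-₅ x) ≡ indicator≢0 x
indicator≢0-neg = from-yes (all? λ x → indicator≢0 (-₅ x) ≟ℤ indicator≢0 x)

-- For distinct v and v′ the factor is the indicator of the complement of {v , v′}; with v′ = -v
-- this removes a whole class from a count.
∑ᵛ-delete : ∀ {n} (v v′ : Vec 𝔽₅ n) (f : Vec 𝔽₅ n → ℤ) →
  ∑ᵛ (λ w → (1ℤ - (⟦ w ≟ᵛ v ⟧ + ⟦ w ≟ᵛ v′ ⟧)) * f w) ≡ ∑ᵛ f - (f v + f v′)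
∑ᵛ-delete {n} v v′ f = begin
  ∑ᵛ (λ w → (1ℤ - (⟦ w ≟ᵛ v ⟧ + ⟦ w ≟ᵛ v′ ⟧)) * f w)
    ≡⟨ ∑-cong (vectors n) (λ w → expand ⟦ w ≟ᵛ v ⟧ ⟦ w ≟ᵛ v′ ⟧ (f w)) ⟩
  ∑ᵛ (λ w → 1ℤ * f w + -1ℤ * (⟦ w ≟ᵛ v ⟧ * f w + ⟦ w ≟ᵛ v′ ⟧ * f w))
    ≡⟨ ∑-linear (vectors n) 1ℤ -1ℤ f (λ w → ⟦ w ≟ᵛ v ⟧ * f w + ⟦ w ≟ᵛ v′ ⟧ * f w) ⟩
  1ℤ * ∑ᵛ f + -1ℤ * ∑ᵛ (λ w → ⟦ w ≟ᵛ v ⟧ * f w + ⟦ w ≟ᵛ v′ ⟧ * f w)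
    ≡⟨ cong (λ s → 1ℤ * ∑ᵛ f + -1ℤ * s)
         (trans (∑-distrib-+ (vectors n) (λ w → ⟦ w ≟ᵛ v ⟧ * f w) (λ w → ⟦ w ≟ᵛ v′ ⟧ * f w))
                (cong₂ _+_ (∑ᵛ-δ v f) (∑ᵛ-δ v′ f))) ⟩
  1ℤ * ∑ᵛ f + -1ℤ * (f v + f v′)
    ≡⟨ tidy (∑ᵛ f) (f v + f v′) ⟩
  ∑ᵛ f - (f v + f v′) ∎
  where
  open ≡-Reasoning
  expand : ∀ a b c → (1ℤ - (a + b)) * c ≡ 1ℤ * c + -1ℤ * (a * c + b * c)
  expand = solve-∀
  tidy : ∀ s t → 1ℤ * s + -1ℤ * t ≡ s - t
  tidy = solve-∀

module Graphs {n : ℕ} (Q : QuadraticForm n) (finite : ∃[ c ] HasSize (S⁺ Q) c) where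
  open QuadraticForm Q renaming (form to q) using (B)
  open Form Q
  open Setoid (S⁺ Q) using (_≈_) renaming (Carrier to Vertex)

  ≈-closed : {P : 𝔽₅ → Set} → (∀ x → P x → P (-₅ x)) →
             ∀ u (v w : Vertex) → v ≈ w → P (B u (proj₁ v)) → P (B u (proj₁ w))
  ≈-closed P-neg u (v , _) (.v , _) (inj₁ refl) p = p
  ≈-closed {P} P-neg u (v , _) (w , _) (inj₂ refl) p =
    subst P (from-yes (all? λ x → (-₅ (-₅ x)) ≟₅ x) (B u w)) (P-neg _ (subst P (B-negʳ u w) p))

  module _ {P : 𝔽₅ → Set} (P? : ∀ x → Dec (P x)) (P-neg : ∀ x → P x → P (-₅ x)) where

    closedʳ : ∀ {u v w : Vertex} → v ≈ w → P (B (proj₁ u) (proj₁ v)) → P (B (proj₁ u) (proj₁ w))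
    closedʳ {u , _} {v} {w} = ≈-closed {P} P-neg u v w

    closedˡ : ∀ {u v w : Vertex} → v ≈ w → P (B (proj₁ v) (proj₁ u)) → P (B (proj₁ w) (proj₁ u))
    closedˡ {u , _} {v} {w} v≈w p =
      subst P (B-sym u (proj₁ w)) (≈-closed {P} P-neg u v w v≈w (subst P (B-sym (proj₁ v) u) p))

    -- Changing a representative negates B, so invariance of `P` under negation makes adjacency well
    -- defined on classes. Since B(u,u) = 1, excluding the value 1 gives irreflexivity.
    relationGraph : ¬ P 1# → Graph (S⁺ Q)
    relationGraph ¬P1 = record
      { Adj    = λ v u → P (B (proj₁ v) (proj₁ u))
      ; adj?   = λ v u → P? (B (proj₁ v) (proj₁ u))
      ; resp   = (λ {u} {v} {w} → closedʳ {u} {v} {w}) , (λ {u} {v} {w} → closedˡ {u} {v} {w})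
      ; sym    = λ {v} {u} → subst P (B-sym (proj₁ v) (proj₁ u))
      ; irrefl = λ {v} {u} v≈u p → ¬P1 (subst P (trans (B-diagonal (proj₁ u)) (proj₂ u))
                                          (closedˡ {u} {v} {u} v≈u p))
      ; finite = finite
      }

  ≢0-neg : ∀ x → x ≢ 0# → -₅ x ≢ 0#
  ≢0-neg = from-yes (all? λ x → ¬? (x ≟₅ 0#) →-dec ¬? ((-₅ x) ≟₅ 0#))

  Γ₀ : Graph (S⁺ Q)
  Γ₀ = relationGraph (_≟₅ 0#) (from-yes (all? λ x → (x ≟₅ 0#) →-dec ((-₅ x) ≟₅ 0#))) (λ ())

  ±2-neg : ∀ x → x ≡ 2# ⊎ x ≡ -₅ 2# → -₅ x ≡ 2# ⊎ -₅ x ≡ -₅ 2#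
  ±2-neg = from-yes (all? λ x → ((x ≟₅ 2#) ⊎-dec (x ≟₅ (-₅ 2#))) →-dec
                                (((-₅ x) ≟₅ 2#) ⊎-dec ((-₅ x) ≟₅ (-₅ 2#))))

  Γ₂ : Graph (S⁺ Q)
  Γ₂ = relationGraph (λ x → (x ≟₅ 2#) ⊎-dec (x ≟₅ (-₅ 2#))) ±2-neg λ { (inj₁ ()) ; (inj₂ ()) }

  -- The admissible values ±1, ±2 include B(v,v) = 1, so `relationGraph` does not apply and loops
  -- are excluded by an explicit inequality.
  Γ₁₂ : Graph (S⁺ Q)
  Γ₁₂ = record
    { Adj    = λ v u → ¬ (v ≈ u) × B (proj₁ v) (proj₁ u) ≢ 0#
    ; adj?   = λ v u → ¬? (_≈±?_ Q v u) ×-dec ¬? (B (proj₁ v) (proj₁ u) ≟₅ 0#)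
    ; resp   = (λ {u} {v} {w} v≈w (u≉v , β≢0) →
                 (λ u≈w → u≉v (S.trans {u} {w} {v} u≈w (S.sym {v} {w} v≈w)))
                 , closedʳ ≢0? ≢0-neg {u} {v} {w} v≈w β≢0)
             , (λ {u} {v} {w} v≈w (v≉u , β≢0) →
                 (λ w≈u → v≉u (S.trans {v} {w} {u} v≈w w≈u))
                 , closedˡ ≢0? ≢0-neg {u} {v} {w} v≈w β≢0)
    ; sym    = λ {v} {u} (v≉u , β≢0) → (λ u≈v → v≉u (S.sym {u} {v} u≈v))
                                      , λ β≡0 → β≢0 (trans (B-sym (proj₁ v) (proj₁ u)) β≡0)
    ; irrefl = λ v≈u (v≉u , _) → v≉u v≈u
    ; finite = finite
    }
    where
    module S = Setoid (S⁺ Q)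

    ≢0? : ∀ x → Dec (x ≢ 0#)
    ≢0? x = ¬? (x ≟₅ 0#)

  ≈⇒B≡±1 : ∀ (v u : Vertex) → v ≈ u → B (proj₁ v) (proj₁ u) ≡ 1# ⊎ B (proj₁ v) (proj₁ u) ≡ -₅ 1#
  ≈⇒B≡±1 (v , qv≡1) (.v , _) (inj₁ refl) = inj₁ (trans (B-diagonal v) qv≡1)
  ≈⇒B≡±1 (v , _) (u , qu≡1) (inj₂ refl) =
    inj₂ (trans (B-negˡ u u) (cong -₅_ (trans (B-diagonal u) qu≡1)))

  -- If v = ±u then B = ±1, which makes the A₂ entry 0, while the inequality makes the other two 0.
  -- Otherwise the five values of B are run through.
  Γ₁₂-hasAdjacencyMatrix : Graph.HasAdjacencyMatrix Γ₁₂ (A₁ Q ⊕ A₂ Q)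
  Γ₁₂-hasAdjacencyMatrix v u = split (_≈±?_ Q v u) (B (proj₁ v) (proj₁ u)) (≈⇒B≡±1 v u)
    where
    matrixEntry : {P : Set} → Dec P → ℕ
    matrixEntry P? = if does P? then 1 else 0

    split : {P : Set} (P? : Dec P) (β : 𝔽₅) → (P → β ≡ 1# ⊎ β ≡ -₅ 1#) →
      matrixEntry (¬? P? ×-dec ((β ≟₅ 1#) ⊎-dec (β ≟₅ (-₅ 1#))))
        ℕ.+ matrixEntry ((β ≟₅ 2#) ⊎-dec (β ≟₅ (-₅ 2#)))
        ≡ matrixEntry (¬? P? ×-dec ¬? (β ≟₅ 0#))
    split (yes p) β P⇒±1 with P⇒±1 p
    ... | inj₁ refl = refl
    ... | inj₂ refl = refl
    split (no _)  0F _ = refl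
    split (no _)  1F _ = refl
    split (no _)  2F _ = refl
    split (no _)  3F _ = refl
    split (no _)  4F _ = refl

-- Valencies and common neighbours

module Parameters {n : ℕ} (Q : QuadraticForm n) (nondegenerate : QuadraticForm.Nondegenerate Q)
  (X e : ℤ) (5^n≡ : (+ 5) ^ n ≡ + 3125 * (X * X))
  (represent≡ : ∀ y → Form.represent Q y ≡ + 625 * (X * X) + + 25 * e * μ y) where

  open QuadraticForm Q renaming (form to q) using (B)
  open Form Q
  open Classes Q
  open Counting Q nondegenerate X e 5^n≡ represent≡
  open Setoid (S⁺ Q) using (_≈_; _≉_) renaming (Carrier to Vertex)

  size : ∀ N → + 2 * + N ≡ + 625 * (X * X) + + 25 * e → HasSize (S⁺ Q) N
  size N 2N≡ = hasSize N (trans 2N≡ (trans (cong (λ s → + 625 * (X * X) + s) (sym (ℤ.*-identityʳ (+ 25 * e))))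
                                           (sym (represent≡ 1#))))

  module _ {P : 𝔽₅ → Set} (P? : ∀ x → Dec (P x)) (P-neg : ∀ x → P x → P (-₅ x)) where

    private
      φ : 𝔽₅ → ℤ
      φ x = ⟦ P? x ⟧

      P-negʳ : ∀ v w → P (B v w) → P (B v (-ᴹ w))
      P-negʳ v w p = subst P (sym (B-negʳ v w)) (P-neg _ p)

    valency : ∀ (v : Vertex) k → + 2 * + k ≡ + 125 * (X * X) * weight₁ φ + + 5 * e * twist₁ φ →
              SubsetHasSize (S⁺ Q) (λ w → P (B (proj₁ v) (proj₁ w))) k
    valency (v , qv≡1) k 2k≡ = subsetHasSize (λ w → P? (B v w)) (P-negʳ v _) k
      (trans 2k≡ (trans (sym (total₁ v qv≡1 φ))
        (∑-cong (vectors n) (λ w → sym (⟦⟧-× (q w ≟₅ 1#) (P? (B v w)))))))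

    common : ∀ (v u : Vertex) → v ≉ u → ∀ k →
             + 2 * + k ≡ + 25 * (X * X) * weight₂ φ + e * twist₂ φ (B (proj₁ v) (proj₁ u)) →
             SubsetHasSize (S⁺ Q) (λ w → P (B (proj₁ v) (proj₁ w)) × P (B (proj₁ u) (proj₁ w))) k
    common (v , qv≡1) (u , qu≡1) v≉u k 2k≡ =
      subsetHasSize (λ w → P? (B v w) ×-dec P? (B u w)) (λ (p , p′) → P-negʳ v _ p , P-negʳ u _ p′) k
        (trans 2k≡ (trans (sym (total₂ v u qv≡1 qu≡1 (v≉u ∘ inj₁) (v≉u ∘ inj₂) φ))
          (∑-cong (vectors n) (λ w → sym (trans (⟦⟧-× (q w ≟₅ 1#) (P? (B v w) ×-dec P? (B u w)))
            (cong (⟦ q w ≟₅ 1# ⟧ *_) (⟦⟧-× (P? (B v w)) (P? (B u w)))))))))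

  near? : (v w : Vec 𝔽₅ n) → Dec (v ≡ w ⊎ v ≡ -ᴹ w)
  near? v w = (v ≟ᵛ w) ⊎-dec (v ≟ᵛ (-ᴹ w))

  near-neg : ∀ {v w} → v ≡ -ᴹ w ⊎ v ≡ -ᴹ (-ᴹ w) → v ≡ w ⊎ v ≡ -ᴹ w
  near-neg (inj₁ v≡-w)  = inj₂ v≡-w
  near-neg (inj₂ v≡--w) = inj₁ (trans v≡--w (-ᴹ-involutive _))

  deleted : Vec 𝔽₅ n → Vec 𝔽₅ n → ℤ
  deleted v w = 1ℤ - (⟦ w ≟ᵛ v ⟧ + ⟦ w ≟ᵛ (-ᴹ v) ⟧)

  deleted-far : ∀ {v w} → v ≢ w → v ≢ -ᴹ w → deleted v w ≡ 1ℤ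
  deleted-far {v} {w} v≢w v≢-w = cong₂ (λ a b → 1ℤ - (a + b))
    (⟦⟧-false (w ≟ᵛ v) (v≢w ∘ sym))
    (⟦⟧-false (w ≟ᵛ (-ᴹ v)) (λ w≡-v → v≢-w (trans (sym (-ᴹ-involutive v)) (cong -ᴹ_ (sym w≡-v)))))

  -- Were v = -v, the two deltas would coincide and `deleted` would take the value -1; B(v,v) = 1 ≠
  -- -1 rules this out.
  ⟦¬near⟧ : ∀ {v} → q v ≡ 1# → ∀ w → ⟦ ¬? (near? v w) ⟧ ≡ deleted v w
  ⟦¬near⟧ {v} qv≡1 w with v ≟ᵛ w
  ... | yes refl = sym (cong₂ (λ a b → 1ℤ - (a + b)) (⟦⟧-true (v ≟ᵛ v) refl) (⟦⟧-false (v ≟ᵛ (-ᴹ v)) v≢-v))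
    where
    v≢-v : v ≢ -ᴹ v
    v≢-v v≡-v = 1≢-1 (trans (sym (trans (B-diagonal v) qv≡1)) (trans (cong (B v) v≡-v)
                  (trans (B-negʳ v v) (cong -₅_ (trans (B-diagonal v) qv≡1)))))
      where
      1≢-1 : 1# ≢ -₅ 1#
      1≢-1 ()
  ... | no v≢w with v ≟ᵛ (-ᴹ w)
  ...   | yes refl = sym (cong₂ (λ a b → 1ℤ - (a + b)) (⟦⟧-false (w ≟ᵛ (-ᴹ w)) (v≢w ∘ sym))
                       (⟦⟧-true (w ≟ᵛ (-ᴹ (-ᴹ w))) (sym (-ᴹ-involutive w))))
  ...   | no v≢-w  = sym (deleted-far v≢w v≢-w)

  ≢0? : ∀ x → Dec (x ≢ 0#)
  ≢0? x = ¬? (x ≟₅ 0#)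

  Far : Vec 𝔽₅ n → Vec 𝔽₅ n → Set
  Far v w = ¬ (v ≡ w ⊎ v ≡ -ᴹ w) × B v w ≢ 0#

  far? : ∀ v w → Dec (Far v w)
  far? v w = ¬? (near? v w) ×-dec ≢0? (B v w)

  far-neg : ∀ {v w} → Far v w → Far v (-ᴹ w)
  far-neg {v} {w} (v≉w , β≢0) = v≉w ∘ near-neg
    , λ β≡0 → β≢0 (neg≡0 (B v w) (trans (sym (B-negʳ v w)) β≡0))
    where
    neg≡0 : ∀ x → -₅ x ≡ 0# → x ≡ 0#
    neg≡0 = from-yes (all? λ x → ((-₅ x) ≟₅ 0#) →-dec (x ≟₅ 0#))

  ⟦far⟧ : ∀ {v} → q v ≡ 1# → ∀ w → ⟦ far? v w ⟧ ≡ deleted v w * indicator≢0 (B v w)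
  ⟦far⟧ {v} qv≡1 w = trans (⟦⟧-× (¬? (near? v w)) (≢0? (B v w))) (cong (_* indicator≢0 (B v w)) (⟦¬near⟧ qv≡1 w))

  -- The 2 subtracted accounts for v and -v, which are unit vectors not orthogonal to v.
  far-valency : ∀ (v : Vertex) → SubsetHasSize (S⁺ Q) (λ w → Far (proj₁ v) (proj₁ w))
    (∣ + 125 * (X * X) * weight₁ indicator≢0 + + 5 * e * twist₁ indicator≢0 - + 2 ∣ / 2)
  far-valency (v , qv≡1) = subsetHasSize-half (far? v) far-neg sum≡
    where
    open ≡-Reasoning

    f : Vec 𝔽₅ n → ℤ
    f w = ⟦ q w ≟₅ 1# ⟧ * indicator≢0 (B v w)

    swap : ∀ a b c → a * (b * c) ≡ b * (a * c)
    swap = solve-∀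

    fv≡1 : f v ≡ 1ℤ
    fv≡1 = cong₂ _*_ (⟦⟧-true (q v ≟₅ 1#) qv≡1) (cong indicator≢0 (trans (B-diagonal v) qv≡1))

    f-v≡1 : f (-ᴹ v) ≡ 1ℤ
    f-v≡1 = cong₂ _*_ (⟦⟧-true (q (-ᴹ v) ≟₅ 1#) (trans (q-neg v) qv≡1))
      (trans (cong indicator≢0 (B-negʳ v v)) (trans (indicator≢0-neg (B v v))
        (cong indicator≢0 (trans (B-diagonal v) qv≡1))))

    sum≡ : ∑ᵛ (λ w → ⟦ (q w ≟₅ 1#) ×-dec far? v w ⟧)
           ≡ + 125 * (X * X) * weight₁ indicator≢0 + + 5 * e * twist₁ indicator≢0 - + 2
    sum≡ = begin
      ∑ᵛ (λ w → ⟦ (q w ≟₅ 1#) ×-dec far? v w ⟧)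
        ≡⟨ ∑-cong (vectors n) (λ w → trans (⟦⟧-× (q w ≟₅ 1#) (far? v w))
             (trans (cong (⟦ q w ≟₅ 1# ⟧ *_) (⟦far⟧ qv≡1 w))
                    (swap ⟦ q w ≟₅ 1# ⟧ (deleted v w) (indicator≢0 (B v w))))) ⟩
      ∑ᵛ (λ w → deleted v w * f w)
        ≡⟨ ∑ᵛ-delete v (-ᴹ v) f ⟩
      ∑ᵛ f - (f v + f (-ᴹ v))
        ≡⟨ cong₂ _-_ (total₁ v qv≡1 indicator≢0) (cong₂ _+_ fv≡1 f-v≡1) ⟩
      + 125 * (X * X) * weight₁ indicator≢0 + + 5 * e * twist₁ indicator≢0 - + 2 ∎

  -- The four vectors ±v, ±u must be removed from the count of `total₂`, and each was counted κ
  -- times, κ being 1 or 0 according to whether B(v,u) is nonzero. Passing κ and t as numbers makes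
  -- the resulting size visibly independent of the pair.
  far-common : ∀ (v u : Vertex) → v ≉ u → ∀ κ t →
    indicator≢0 (B (proj₁ v) (proj₁ u)) ≡ κ → twist₂ indicator≢0 (B (proj₁ v) (proj₁ u)) ≡ t →
    SubsetHasSize (S⁺ Q) (λ w → Far (proj₁ v) (proj₁ w) × Far (proj₁ u) (proj₁ w))
      (∣ + 25 * (X * X) * weight₂ indicator≢0 + e * t - (κ + κ) - (κ + κ) ∣ / 2)
  far-common (v , qv≡1) (u , qu≡1) v≉u κ t κ≡ t≡ =
    subsetHasSize-half both? both-neg sum≡
    where
    open ≡-Reasoning

    both? : ∀ w → Dec (Far v w × Far u w)
    both? w = far? v w ×-dec far? u w

    both-neg : ∀ {w} → Far v w × Far u w → Far v (-ᴹ w) × Far u (-ᴹ w)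
    both-neg (far-v , far-u) = far-neg far-v , far-neg far-u

    f : Vec 𝔽₅ n → ℤ
    f w = ⟦ q w ≟₅ 1# ⟧ * (indicator≢0 (B v w) * indicator≢0 (B u w))

    f-neg : ∀ w → f (-ᴹ w) ≡ f w
    f-neg w = cong₂ _*_ (cong (λ z → ⟦ z ≟₅ 1# ⟧) (q-neg w)) (cong₂ _*_
      (trans (cong indicator≢0 (B-negʳ v w)) (indicator≢0-neg (B v w)))
      (trans (cong indicator≢0 (B-negʳ u w)) (indicator≢0-neg (B u w))))

    fv≡κ : f v ≡ κ
    fv≡κ = trans (cong₂ _*_ (⟦⟧-true (q v ≟₅ 1#) qv≡1)
      (cong₂ _*_ (cong indicator≢0 (trans (B-diagonal v) qv≡1)) (trans (cong indicator≢0 (B-sym u v)) κ≡)))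
      (trans (ℤ.*-identityˡ (1ℤ * κ)) (ℤ.*-identityˡ κ))

    fu≡κ : f u ≡ κ
    fu≡κ = trans (cong₂ _*_ (⟦⟧-true (q u ≟₅ 1#) qu≡1)
      (cong₂ _*_ κ≡ (cong indicator≢0 (trans (B-diagonal u) qu≡1))))
      (trans (ℤ.*-identityˡ (κ * 1ℤ)) (ℤ.*-identityʳ κ))

    g : Vec 𝔽₅ n → ℤ
    g w = deleted v w * f w

    -- As u ≠ ±v, deleting ±v leaves the values at ±u unchanged, so the two deletions do not
    -- interfere.
    gu≡κ : g u ≡ κ
    gu≡κ = trans (cong₂ _*_ (deleted-far (v≉u ∘ inj₁) (v≉u ∘ inj₂)) fu≡κ) (ℤ.*-identityˡ κ)

    g-u≡κ : g (-ᴹ u) ≡ κ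
    g-u≡κ = trans (cong₂ _*_ (deleted-far (v≉u ∘ inj₂) (λ v≡--u → v≉u (inj₁ (trans v≡--u (-ᴹ-involutive u)))))
                             (trans (f-neg u) fu≡κ)) (ℤ.*-identityˡ κ)

    rearrange : ∀ c a x b y → c * (a * x * (b * y)) ≡ b * (a * (c * (x * y)))
    rearrange = solve-∀

    sum≡ : ∑ᵛ (λ w → ⟦ (q w ≟₅ 1#) ×-dec both? w ⟧)
           ≡ + 25 * (X * X) * weight₂ indicator≢0 + e * t - (κ + κ) - (κ + κ)
    sum≡ = begin
      ∑ᵛ (λ w → ⟦ (q w ≟₅ 1#) ×-dec both? w ⟧)
        ≡⟨ ∑-cong (vectors n) (λ w → trans (⟦⟧-× (q w ≟₅ 1#) (both? w))
             (trans (cong (⟦ q w ≟₅ 1# ⟧ *_) (trans (⟦⟧-× (far? v w) (far? u w))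
                      (cong₂ _*_ (⟦far⟧ qv≡1 w) (⟦far⟧ qu≡1 w))))
                    (rearrange ⟦ q w ≟₅ 1# ⟧ (deleted v w) (indicator≢0 (B v w)) (deleted u w) (indicator≢0 (B u w))))) ⟩
      ∑ᵛ (λ w → deleted u w * g w)
        ≡⟨ ∑ᵛ-delete u (-ᴹ u) g ⟩
      ∑ᵛ g - (g u + g (-ᴹ u))
        ≡⟨ cong₂ _-_ (∑ᵛ-delete v (-ᴹ v) f) (cong₂ _+_ gu≡κ g-u≡κ) ⟩
      ∑ᵛ f - (f v + f (-ᴹ v)) - (κ + κ)
        ≡⟨ cong₂ (λ s s′ → s - s′ - (κ + κ))
             (trans (total₂ v u qv≡1 qu≡1 (v≉u ∘ inj₁) (v≉u ∘ inj₂) indicator≢0)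
                    (cong (λ t → + 25 * (X * X) * weight₂ indicator≢0 + e * t) t≡))
             (cong₂ _+_ fv≡κ (trans (f-neg v) fv≡κ)) ⟩
      + 25 * (X * X) * weight₂ indicator≢0 + e * t - (κ + κ) - (κ + κ) ∎


-- Numerical parameters

odd-power : ∀ j → ∃[ y ] (+ 5) ^ j ≡ 1ℤ + + 2 * + y
odd-power zero    = 0 , refl
odd-power (suc j) with y , 5^j≡ ← odd-power j = 2 ℕ.+ 5 ℕ.* y , (begin
  + 5 * (+ 5) ^ j                       ≡⟨ cong (+ 5 *_) 5^j≡ ⟩
  + 5 * (1ℤ + + 2 * + y)                ≡⟨ expand (+ y) ⟩
  1ℤ + + 2 * (+ 2 + + 5 * + y)          ≡⟨ cong (λ z → 1ℤ + + 2 * (+ 2 + z)) (ℤ.pos-* 5 y) ⟨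
  1ℤ + + 2 * + (2 ℕ.+ 5 ℕ.* y)         ∎)
  where
  open ≡-Reasoning
  expand : ∀ y → + 5 * (1ℤ + + 2 * y) ≡ 1ℤ + + 2 * (+ 2 + + 5 * y)
  expand = solve-∀

^-double : ∀ (a : ℤ) j → a ^ (j ℕ.* 2) ≡ a ^ j * a ^ j
^-double a zero    = refl
^-double a (suc j) = trans (cong (λ z → a * (a * z)) (^-double a j)) (regroup a (a ^ j))
  where
  regroup : ∀ a b → a * (a * (b * b)) ≡ a * b * (a * b)
  regroup = solve-∀

-- X(X + 1) and X(X - 1) are even for odd X. The witnesses are natural numbers, so nonnegativity
-- comes along with integrality.
consecutive-even : ∀ {X} y → X ≡ 1ℤ + + 2 * + y →
  (∃[ h ] + 2 * + h ≡ X * X + X) × (∃[ h ] + 2 * + h ≡ X * X - X)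
consecutive-even y refl =
  ((1 ℕ.+ 2 ℕ.* y) ℕ.* (1 ℕ.+ y) , trans (cong (+ 2 *_) (trans (ℤ.pos-* (1 ℕ.+ 2 ℕ.* y) (1 ℕ.+ y))
     (cong (λ z → (1ℤ + z) * (1ℤ + + y)) (ℤ.pos-* 2 y)))) (plus (+ y))) ,
  ((1 ℕ.+ 2 ℕ.* y) ℕ.* y , trans (cong (+ 2 *_) (trans (ℤ.pos-* (1 ℕ.+ 2 ℕ.* y) y)
     (cong (λ z → (1ℤ + z) * + y) (ℤ.pos-* 2 y)))) (minus (+ y)))
  where
  plus : ∀ y → + 2 * ((1ℤ + + 2 * y) * (1ℤ + y)) ≡ (1ℤ + + 2 * y) * (1ℤ + + 2 * y) + (1ℤ + + 2 * y)
  plus = solve-∀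
  minus : ∀ y → + 2 * ((1ℤ + + 2 * y) * y) ≡ (1ℤ + + 2 * y) * (1ℤ + + 2 * y) - (1ℤ + + 2 * y)
  minus = solve-∀

opaque
  half-sum : ∀ a c (h x : ℕ) {E X : ℤ} → + 2 * + h ≡ E → X ≡ + x →
             ∃[ k ] + 2 * + k ≡ + a * E + + 2 * + c * (X * X)
  half-sum a c h x refl refl = a ℕ.* h ℕ.+ c ℕ.* (x ℕ.* x) ,
    trans (cong (+ 2 *_) (cong₂ _+_ (ℤ.pos-* a h) (trans (ℤ.pos-* c (x ℕ.* x)) (cong (+ c *_) (ℤ.pos-* x x)))))
          (expand (+ a) (+ h) (+ c) (+ x * + x))
    where
    expand : ∀ a h c z → + 2 * (a * h + c * z) ≡ a * (+ 2 * h) + + 2 * c * z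
    expand = solve-∀

μ≡±1 : ∀ d → d ≢ 0# → μ d ≡ 1ℤ ⊎ μ d ≡ -1ℤ
μ≡±1 = from-yes (all? λ d → ¬? (d ≟₅ 0#) →-dec ((μ d ≟ℤ 1ℤ) ⊎-dec (μ d ≟ℤ -1ℤ)))

odd>3 : ∀ n → 3 < n → n % 2 ≡ 1 → ∃[ j ] n ≡ 5 ℕ.+ j ℕ.* 2
odd>3 n 3<n n%2≡1 = split (n / 2) (trans (m≡m%n+[m/n]*n n 2) (cong (ℕ._+ (n / 2) ℕ.* 2) n%2≡1))
  where
  split : ∀ m → n ≡ 1 ℕ.+ m ℕ.* 2 → ∃[ j ] n ≡ 5 ℕ.+ j ℕ.* 2
  split zero          n≡ = contradiction (subst (3 <_) n≡ 3<n) λ { (ℕ.s≤s ()) }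
  split (suc zero)    n≡ = contradiction (subst (3 <_) n≡ 3<n) λ { (ℕ.s≤s (ℕ.s≤s (ℕ.s≤s ()))) }
  split (suc (suc j)) n≡ = j , n≡

-- The equivalence with the standard form is a bijection of 𝔽₅ⁿ, so it preserves the number of
-- representations.
represent-det : ∀ m (Q : QuadraticForm (suc (m ℕ.* 2))) d → IsDet Q d → ∀ y →
  Form.represent Q y ≡ (+ 5) ^ m * (+ 5) ^ m + (+ 5) ^ m * (μ d * μ y)
represent-det m Q d (d≢0 , T , T-isIso , QT≡) y = begin
  ∑ᵛ (λ w → ⟦ q w ≟₅ y ⟧)                ≡⟨ ∑ᵛ-reindex (Iso.injective , Iso.surjective) (λ w → ⟦ q w ≟₅ y ⟧) ⟨
  ∑ᵛ (λ w → ⟦ q (T w) ≟₅ y ⟧)            ≡⟨ ∑-cong (vectors _) (λ w → cong (λ z → ⟦ z ≟₅ y ⟧) (QT≡ w)) ⟩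
  ∑ᵛ (λ w → ⟦ standardForm d w ≟₅ y ⟧)   ≡⟨ count-standardForm m d d≢0 y ⟩
  (+ 5) ^ m * (+ 5) ^ m + (+ 5) ^ m * (μ d * μ y) ∎
  where
  open ≡-Reasoning
  open QuadraticForm Q renaming (form to q) using ()
  rawModule = LeftModule.rawLeftModule (𝔽₅^ (suc (m ℕ.* 2)))
  module Iso = LeftModuleMorphisms.IsLeftModuleIsomorphism {M₁ = rawModule} {M₂ = rawModule} T-isIso

if-yes : {P : Set} (P? : Dec P) {a b : ℤ} → P → (if does P? then a else b) ≡ a
if-yes (yes _) p = refl
if-yes (no ¬p) p = contradiction p ¬p

if-no : {P : Set} (P? : Dec P) {a b : ℤ} → ¬ P → (if does P? then a else b) ≡ b
if-no (yes p) ¬p = contradiction p ¬p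
if-no (no _)  ¬p = refl

-- The graphs and their parameters in dimension n = 5 + 2j

module Main (j : ℕ) (Q : QuadraticForm (5 ℕ.+ j ℕ.* 2)) (nondegenerate : QuadraticForm.Nondegenerate Q)
  (d : 𝔽₅) (isDet : IsDet Q d) where

  open QuadraticForm Q using (B)

  X ε e : ℤ
  X = (+ 5) ^ j
  ε = μ d
  e = X * ε

  x : ℕ
  x = 1 ℕ.+ 2 ℕ.* proj₁ (odd-power j)

  X≡x : X ≡ + x
  X≡x = trans (proj₂ (odd-power j)) (cong (λ z → 1ℤ + z) (sym (ℤ.pos-* 2 (proj₁ (odd-power j)))))

  opaque
    halves : (∃[ h ] + 2 * + h ≡ X * X + e) × (∃[ h ] + 2 * + h ≡ X * X - e)
    halves with μ≡±1 d (proj₁ isDet) | consecutive-even {X} (proj₁ (odd-power j)) (proj₂ (odd-power j))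
    ... | inj₁ ε≡1  | (h , h≡) , (h′ , h′≡) =
      (h , trans h≡ (cong (λ z → X * X + z) (sym e≡X))) , (h′ , trans h′≡ (cong (λ z → X * X - z) (sym e≡X)))
      where
      e≡X : e ≡ X
      e≡X = trans (cong (X *_) ε≡1) (ℤ.*-identityʳ X)
    -- With ε = -1 the halves of X² + X and X² - X change places.
    ... | inj₂ ε≡-1 | (h , h≡) , (h′ , h′≡) =
      (h′ , trans h′≡ (cong (λ z → X * X + z) (sym e≡-X))) ,
      (h , trans h≡ (trans (plus X) (cong (λ z → X * X - z) (sym e≡-X))))
      where
      e≡-X : e ≡ - X
      e≡-X = trans (cong (X *_) ε≡-1) (trans (ℤ.*-comm X -1ℤ) (ℤ.-1*i≡-i X))
      plus : ∀ X → X * X + X ≡ X * X - - X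
      plus = solve-∀

  half⁺ : ∀ a c → ∃[ k ] + 2 * + k ≡ + a * (X * X + e) + + 2 * + c * (X * X)
  half⁺ a c = half-sum a c (proj₁ (proj₁ halves)) x (proj₂ (proj₁ halves)) X≡x

  half⁻ : ∀ a c → ∃[ k ] + 2 * + k ≡ + a * (X * X - e) + + 2 * + c * (X * X)
  half⁻ a c = half-sum a c (proj₁ (proj₂ halves)) x (proj₂ (proj₂ halves)) X≡x

  -- The first argument of `half⁺` or `half⁻` is the absolute value of the coefficient of e in the
  -- doubled parameter; the second is half of what the coefficient of X² then still lacks. For
  -- instance 2N = 625X² + 25e = 25(X² + e) + 2·300X².
  N k b a k₀ l₀ m₀ : ℕ
  N  = proj₁ (half⁺ 25 300)
  k  = proj₁ (half⁻ 10 120)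
  b  = proj₁ (half⁻ 20 40)
  a  = proj₁ (half⁻ 10 45)
  k₀ = proj₁ (half⁻ 5 60)
  l₀ = proj₁ (half⁺ 5 10)
  m₀ = proj₁ (half⁻ 5 10)

  2N≡ : + 2 * + N ≡ + 625 * (X * X) + + 25 * e
  2N≡ = trans (proj₂ (half⁺ 25 300)) (tidy (X * X) e)
    where
    tidy : ∀ z e → + 25 * (z + e) + + 2 * + 300 * z ≡ + 625 * z + + 25 * e
    tidy = solve-∀

  k≡ : + k ≡ + 125 * (X * X) - + 5 * e
  k≡ = ℤ.*-cancelˡ-≡ (+ 2) _ _ (trans (proj₂ (half⁻ 10 120)) (tidy (X * X) e))
    where
    tidy : ∀ z e → + 10 * (z - e) + + 2 * + 120 * z ≡ + 2 * (+ 125 * z - + 5 * e)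
    tidy = solve-∀

  b≡ : + b ≡ + 2 * (+ 25 * (X * X) - + 5 * e)
  b≡ = ℤ.*-cancelˡ-≡ (+ 2) _ _ (trans (proj₂ (half⁻ 20 40)) (tidy (X * X) e))
    where
    tidy : ∀ z e → + 20 * (z - e) + + 2 * + 40 * z ≡ + 2 * (+ 2 * (+ 25 * z - + 5 * e))
    tidy = solve-∀

  a≡ : + a ≡ + 2 * (+ 25 * (X * X)) - + 5 * e
  a≡ = ℤ.*-cancelˡ-≡ (+ 2) _ _ (trans (proj₂ (half⁻ 10 45)) (tidy (X * X) e))
    where
    tidy : ∀ z e → + 10 * (z - e) + + 2 * + 45 * z ≡ + 2 * (+ 2 * (+ 25 * z) - + 5 * e)
    tidy = solve-∀

  2k₀≡ : + 2 * + k₀ ≡ + 125 * (X * X) - + 5 * e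
  2k₀≡ = trans (proj₂ (half⁻ 5 60)) (tidy (X * X) e)
    where
    tidy : ∀ z e → + 5 * (z - e) + + 2 * + 60 * z ≡ + 125 * z - + 5 * e
    tidy = solve-∀

  2l₀≡ : + 2 * + l₀ ≡ + 25 * (X * X) + + 5 * e
  2l₀≡ = trans (proj₂ (half⁺ 5 10)) (tidy (X * X) e)
    where
    tidy : ∀ z e → + 5 * (z + e) + + 2 * + 10 * z ≡ + 25 * z + + 5 * e
    tidy = solve-∀

  2m₀≡ : + 2 * + m₀ ≡ + 25 * (X * X) - + 5 * e
  2m₀≡ = trans (proj₂ (half⁻ 5 10)) (tidy (X * X) e)
    where
    tidy : ∀ z e → + 5 * (z - e) + + 2 * + 10 * z ≡ + 25 * z - + 5 * e
    tidy = solve-∀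

  -- The difference a - b is 5e, and e = ±5ʲ is nonzero.
  a≢b : a ≢ b
  a≢b a≡b = contradiction (ℤ.i*j≡0⇒i≡0∨j≡0 X e≡0) λ
    { (inj₁ X≡0) → x≢0 (trans (sym X≡x) X≡0)
    ; (inj₂ ε≡0) → ε≢0 (μ≡±1 d (proj₁ isDet)) ε≡0 }
    where
    difference : ∀ z e → + 5 * e ≡ + 2 * (+ 25 * z) - + 5 * e - + 2 * (+ 25 * z - + 5 * e)
    difference = solve-∀

    e≡0 : e ≡ 0ℤ
    e≡0 = ℤ.*-cancelˡ-≡ (+ 5) _ _ (trans (difference (X * X) e)
      (ℤ.i≡j⇒i-j≡0 (trans (sym a≡) (trans (cong +_ a≡b) b≡))))

    x≢0 : + x ≢ 0ℤ
    x≢0 ()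

    ε≢0 : ε ≡ 1ℤ ⊎ ε ≡ -1ℤ → ε ≢ 0ℤ
    ε≢0 (inj₁ ε≡1)  ε≡0 = contradiction (trans (sym ε≡1) ε≡0) λ ()
    ε≢0 (inj₂ ε≡-1) ε≡0 = contradiction (trans (sym ε≡-1) ε≡0) λ ()

  power : ∀ i → (+ 5) ^ (i ℕ.+ j ℕ.* 2) ≡ (+ 5) ^ i * (X * X)
  power i = trans (ℤ.^-distribˡ-+-* (+ 5) i (j ℕ.* 2)) (cong ((+ 5) ^ i *_) (^-double (+ 5) j))

  represent≡ : ∀ y → Form.represent Q y ≡ + 625 * (X * X) + + 25 * e * μ y
  represent≡ y = trans (represent-det (2 ℕ.+ j) Q d isDet y) (regroup X ε (μ y))
    where
    regroup : ∀ X ε ν → + 5 * (+ 5 * X) * (+ 5 * (+ 5 * X)) + + 5 * (+ 5 * X) * (ε * ν)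
                        ≡ + 625 * (X * X) + + 25 * (X * ε) * ν
    regroup = solve-∀

  open Parameters Q nondegenerate X e (power 5) represent≡
  open Graphs Q (N , size N 2N≡) using (±2-neg)
  open Graphs Q (N , size N 2N≡) using (Γ₀; Γ₁₂; Γ₂; Γ₁₂-hasAdjacencyMatrix) public

  open Setoid (S⁺ Q) using (_≉_) renaming (Carrier to Vertex)

  0-neg : ∀ z → z ≡ 0# → -₅ z ≡ 0#
  0-neg = from-yes (all? λ z → (z ≟₅ 0#) →-dec ((-₅ z) ≟₅ 0#))

  IsTwo? : ∀ z → Dec (z ≡ 2# ⊎ z ≡ -₅ 2#)
  IsTwo? z = (z ≟₅ 2#) ⊎-dec (z ≟₅ (-₅ 2#))

  two⇒≢0 : ∀ z → z ≡ 2# ⊎ z ≡ -₅ 2# → z ≢ 0#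
  two⇒≢0 = from-yes (all? λ z → IsTwo? z →-dec ¬? (z ≟₅ 0#))

  regular₀ : Graph.Regular Γ₀ k₀
  regular₀ v = valency (_≟₅ 0#) 0-neg v k₀
    -- The literal 1 is the evaluated `weight₁`. The factors 1, 2 and 4 in the other valencies and
    -- counts are likewise numbers of admissible s or (s,t).
    (trans 2k₀≡ (trans (tidy (X * X) e) (cong (λ t → + 125 * (X * X) * 1ℤ + + 5 * e * t) (sym twist₁-indicator₀))))
    where
    tidy : ∀ z e → + 125 * z - + 5 * e ≡ + 125 * z * 1ℤ + + 5 * e * -1ℤ
    tidy = solve-∀

  common₀-adjacent : ∀ u v → u ≉ v → Graph.Adj Γ₀ u v → Graph.CommonNeighbours Γ₀ u v l₀
  common₀-adjacent u v u≉v β≡0 = common (_≟₅ 0#) 0-neg u v u≉v l₀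
    (trans 2l₀≡ (trans (tidy (X * X) e) (cong (λ t → + 25 * (X * X) * 1ℤ + e * t)
      (sym (trans (twist₂-indicator₀ β) (if-yes (β ≟₅ 0#) β≡0))))))
    where
    β = B (proj₁ u) (proj₁ v)
    tidy : ∀ z e → + 25 * z + + 5 * e ≡ + 25 * z * 1ℤ + e * + 5
    tidy = solve-∀

  common₀-nonadjacent : ∀ u v → u ≉ v → ¬ Graph.Adj Γ₀ u v → Graph.CommonNeighbours Γ₀ u v m₀
  common₀-nonadjacent u v u≉v β≢0 = common (_≟₅ 0#) 0-neg u v u≉v m₀
    (trans 2m₀≡ (trans (tidy (X * X) e) (cong (λ t → + 25 * (X * X) * 1ℤ + e * t)
      (sym (trans (twist₂-indicator₀ β) (if-no (β ≟₅ 0#) β≢0))))))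
    where
    β = B (proj₁ u) (proj₁ v)
    tidy : ∀ z e → + 25 * z - + 5 * e ≡ + 25 * z * 1ℤ + e * - + 5
    tidy = solve-∀

  regular₂ : Graph.Regular Γ₂ k
  regular₂ v = valency IsTwo? ±2-neg v k
    (trans (cong (+ 2 *_) k≡) (trans (tidy (X * X) e)
      (cong (λ t → + 125 * (X * X) * + 2 + + 5 * e * t) (sym twist₁-indicator₂))))
    where
    tidy : ∀ z e → + 2 * (+ 125 * z - + 5 * e) ≡ + 125 * z * + 2 + + 5 * e * - + 2
    tidy = solve-∀

  common₂-≡0 : ∀ u v → u ≉ v → B (proj₁ u) (proj₁ v) ≡ 0# → Graph.CommonNeighbours Γ₂ u v b
  common₂-≡0 u v u≉v β≡0 = common IsTwo? ±2-neg u v u≉v b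
    (trans (cong (+ 2 *_) b≡) (trans (tidy (X * X) e) (cong (λ t → + 25 * (X * X) * + 4 + e * t)
      (sym (trans (twist₂-indicator₂ β) (if-yes (β ≟₅ 0#) β≡0))))))
    where
    β = B (proj₁ u) (proj₁ v)
    tidy : ∀ z e → + 2 * (+ 2 * (+ 25 * z - + 5 * e)) ≡ + 25 * z * + 4 + e * - + 20
    tidy = solve-∀

  common₂-≢0 : ∀ u v → u ≉ v → B (proj₁ u) (proj₁ v) ≢ 0# → Graph.CommonNeighbours Γ₂ u v a
  common₂-≢0 u v u≉v β≢0 = common IsTwo? ±2-neg u v u≉v a
    (trans (cong (+ 2 *_) a≡) (trans (tidy (X * X) e) (cong (λ t → + 25 * (X * X) * + 4 + e * t)
      (sym (trans (twist₂-indicator₂ β) (if-no (β ≟₅ 0#) β≢0))))))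
    where
    β = B (proj₁ u) (proj₁ v)
    tidy : ∀ z e → + 2 * (+ 2 * (+ 25 * z) - + 5 * e) ≡ + 25 * z * + 4 + e * - + 10
    tidy = solve-∀

  stronglyRegular₀ : Graph.StronglyRegular Γ₀ N k₀ l₀ m₀
  stronglyRegular₀ = size N 2N≡ , regular₀
    , (λ u v adj → common₀-adjacent u v (λ u≈v → Graph.irrefl Γ₀ {u} {v} u≈v adj) adj)
    , common₀-nonadjacent

  stronglyRegular₁₂ : ∃[ N′ ] ∃[ k′ ] ∃[ l′ ] ∃[ m′ ] Graph.StronglyRegular Γ₁₂ N′ k′ l′ m′
  -- The remaining parameters are inferred from `far-valency` and `far-common`, the latter used with
  -- κ = 1, t = 30 for adjacent and κ = 0, t = 40 for non-adjacent pairs.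
  stronglyRegular₁₂ = N , _ , _ , _ , size N 2N≡ , far-valency
    , (λ u v (u≉v , β≢0) → far-common u v u≉v 1ℤ (+ 30)
        (⟦⟧-true (≢0? (B (proj₁ u) (proj₁ v))) β≢0)
        (trans (twist₂-indicator≢0 (B (proj₁ u) (proj₁ v))) (if-no (B (proj₁ u) (proj₁ v) ≟₅ 0#) β≢0)))
    , (λ u v u≉v ¬adj → let β≡0 = decidable-stable (B (proj₁ u) (proj₁ v) ≟₅ 0#) (λ β≢0 → ¬adj (u≉v , β≢0)) in
        far-common u v u≉v 0ℤ (+ 40)
          (⟦⟧-false (≢0? (B (proj₁ u) (proj₁ v))) (λ β≢0 → β≢0 β≡0))
          (trans (twist₂-indicator≢0 (B (proj₁ u) (proj₁ v))) (if-yes (B (proj₁ u) (proj₁ v) ≟₅ 0#) β≡0)))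

  deza₂ : Graph.Deza Γ₂ N k b a
  deza₂ = size N 2N≡ , regular₂ , λ u v u≉v → split u v u≉v (B (proj₁ u) (proj₁ v) ≟₅ 0#)
    where
    split : ∀ u v → u ≉ v → Dec (B (proj₁ u) (proj₁ v) ≡ 0#) →
            Graph.CommonNeighbours Γ₂ u v a ⊎ Graph.CommonNeighbours Γ₂ u v b
    split u v u≉v (yes β≡0) = inj₂ (common₂-≡0 u v u≉v β≡0)
    split u v u≉v (no β≢0)  = inj₁ (common₂-≢0 u v u≉v β≢0)

  -- Adjacency means B = ±2, which is nonzero, so every edge falls under the case of a common
  -- neighbours.
  edgeRegular₂ : Graph.EdgeRegular Γ₂
  edgeRegular₂ = (k , regular₂) , a , λ u v adj →
    common₂-≢0 u v (λ u≈v → Graph.irrefl Γ₂ {u} {v} u≈v adj) (two⇒≢0 _ adj)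

  complementary : Complementary Γ₀ Γ₁₂
  complementary u v u≉v = mk⇔ (λ β≡0 (_ , β≢0) → β≢0 β≡0)
    (λ ¬adj → decidable-stable (B (proj₁ u) (proj₁ v) ≟₅ 0#) (λ β≢0 → ¬adj (u≉v , β≢0)))

  areChildren : AreChildren Γ₂ b a Γ₀ Γ₁₂
  -- Orthogonal pairs are those with b common neighbours, so `Γ₀` is the child for b. Each converse
  -- holds because the opposite value of the count would give a = b.
  areChildren = a≢b , inj₂
    ( (λ u v u≉v → mk⇔ (common₂-≡0 u v u≉v)
        (λ size-b → decidable-stable (B (proj₁ u) (proj₁ v) ≟₅ 0#)
          (λ β≢0 → a≢b (hasSize-unique (common₂-≢0 u v u≉v β≢0) size-b))))
    , (λ u v u≉v → mk⇔ (λ (_ , β≢0) → common₂-≢0 u v u≉v β≢0)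
        (λ size-a → u≉v , λ β≡0 → a≢b (hasSize-unique size-a (common₂-≡0 u v u≉v β≡0)))))

mainTheorem2 :
  (n : ℕ) → 3 < n → n % 2 ≡ 1 →
  (Q : QuadraticForm n) → QuadraticForm.Nondegenerate Q →
  (d : 𝔽₅) → IsDet Q d →
  let
    ε = μ (((F.- 1#) F.^ ((n ∸ 1) / 2)) F.* d)
    q = + 5
  in
  Σ[ Γ₀ ∈ Graph (S⁺ Q) ] Σ[ Γ₁₂ ∈ Graph (S⁺ Q) ] Σ[ Γ₂ ∈ Graph (S⁺ Q) ]
  Graph.HasAdjacencyMatrix Γ₀ (A₀ Q) ×
  Graph.HasAdjacencyMatrix Γ₁₂ (A₁ Q ⊕ A₂ Q) ×
  Graph.HasAdjacencyMatrix Γ₂ (A₂ Q) ×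
  (∃[ N ] ∃[ k ] ∃[ b ] ∃[ a ] ∃[ k₀ ] ∃[ l₀ ] ∃[ m₀ ]
    (+ 2 * + N ≡ q ^ (n ∸ 1) + ε * q ^ ((n ∸ 1) / 2)) ×
    (+ k ≡ q ^ (n ∸ 2) - ε * q ^ ((n ∸ 3) / 2)) ×
    (+ b ≡ + 2 * (q ^ (n ∸ 3) - ε * q ^ ((n ∸ 3) / 2))) ×
    (+ a ≡ + 2 * q ^ (n ∸ 3) - ε * q ^ ((n ∸ 3) / 2)) ×
    (+ 2 * + k₀ ≡ q ^ (n ∸ 2) - ε * q ^ ((n ∸ 3) / 2)) ×
    (+ 2 * + l₀ ≡ q ^ (n ∸ 3) + ε * q ^ ((n ∸ 3) / 2)) ×
    (+ 2 * + m₀ ≡ q ^ (n ∸ 3) - ε * q ^ ((n ∸ 3) / 2)) ×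
    Graph.Deza Γ₂ N k b a ×
    Graph.EdgeRegular Γ₂ ×
    Complementary Γ₀ Γ₁₂ ×
    (∃[ N′ ] ∃[ k′ ] ∃[ l′ ] ∃[ m′ ] Graph.StronglyRegular Γ₁₂ N′ k′ l′ m′) ×
    AreChildren Γ₂ b a Γ₀ Γ₁₂ ×
    Graph.StronglyRegular Γ₀ N k₀ l₀ m₀)
mainTheorem2 n 3<n n%2≡1 Q nondegenerate d isDet with j , refl ← odd>3 n 3<n n%2≡1 =
  Γ₀ , Γ₁₂ , Γ₂ , (λ _ _ → refl) , Γ₁₂-hasAdjacencyMatrix , (λ _ _ → refl)
  , N , k , b , a , k₀ , l₀ , m₀
  , trans 2N≡ (cong₂ _+_ (sym (power 4)) (sym ε-term₁))
  , trans k≡ (cong₂ _-_ (sym (power 3)) (sym ε-term₂))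
  , trans b≡ (cong (+ 2 *_) (cong₂ _-_ (sym (power 2)) (sym ε-term₂)))
  , trans a≡ (cong₂ _-_ (cong (+ 2 *_) (sym (power 2))) (sym ε-term₂))
  , trans 2k₀≡ (cong₂ _-_ (sym (power 3)) (sym ε-term₂))
  , trans 2l₀≡ (cong₂ _+_ (sym (power 2)) (sym ε-term₂))
  , trans 2m₀≡ (cong₂ _-_ (sym (power 2)) (sym ε-term₂))
  , deza₂ , edgeRegular₂ , complementary , stronglyRegular₁₂ , areChildren , stronglyRegular₀
  where
  open Main j Q nondegenerate d isDet

  regroup₁ : ∀ ε X → ε * (+ 5 * (+ 5 * X)) ≡ + 25 * (X * ε)
  regroup₁ = solve-∀

  regroup₂ : ∀ ε X → ε * (+ 5 * X) ≡ + 5 * (X * ε)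
  regroup₂ = solve-∀

  -- The exponents (n-1)/2 and (n-3)/2 are 2 + j and 1 + j, which account for the factors 25 and 5
  -- in front of e.
  ε-term₁ : μ ((-₅ 1#) ^₅ ((4 ℕ.+ j ℕ.* 2) / 2) *₅ d) * (+ 5) ^ ((4 ℕ.+ j ℕ.* 2) / 2) ≡ + 25 * e
  ε-term₁ = trans (cong₂ _*_ (μ-neg1^-* ((4 ℕ.+ j ℕ.* 2) / 2) d) (cong ((+ 5) ^_) (m*n/n≡m (2 ℕ.+ j) 2)))
                  (regroup₁ (μ d) X)

  ε-term₂ : μ ((-₅ 1#) ^₅ ((4 ℕ.+ j ℕ.* 2) / 2) *₅ d) * (+ 5) ^ ((2 ℕ.+ j ℕ.* 2) / 2) ≡ + 5 * e
  ε-term₂ = trans (cong₂ _*_ (μ-neg1^-* ((4 ℕ.+ j ℕ.* 2) / 2) d) (cong ((+ 5) ^_) (m*n/n≡m (1 ℕ.+ j) 2)))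
                  (regroup₂ (μ d) X)
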